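{- Let $\beta>0$ be real. The asymptotic competitive search ratio $\hat S$ satisfies: (1) $\hat S(\beta)\le 5$ if $\beta\le 19/46$; (2) $\hat S(\beta)\le 7$ if $\beta\le 65/146$.
   Context: Model. $n$ robots with distinct identities start at time $0$ at the origin of the real line and move along the line with speed at most $1$, changing direction or speed at no cost. A target lies at an unknown point at distance $d>0$ from the origin, i.e. at $d$ or $-d$, with $d$ unknown to the robots. At most $f$ robots are faulty; the bound $f$ is known, but not which robots are faulty. A search algorithm assigns each robot a trajectory, known to all robots; a robot's further motion may depend on the messages broadcast so far (computation and communication take no time). A robot detects whether the target is at a point only by being there. The only messages are announcements "the target is here", heard instantly by all robots at any distance; each message automatically carries the true identity and true current location of its sender. A robot visiting a point silently is taken to claim that the target is not there. Reliable (non-faulty) robots follow the algorithm and report truthfully. Faulty robots are controlled by an adversary: they may stay silent at the target or announce the target where it is not; a faulty robot that broadcasts while off its assigned trajectory is thereby detected as faulty. The search is completed at the first time when some reliable robot has visited the target and announced it and all reliable robots can be certain of its location (every scenario with at most $f$ faulty robots consistent with the messages so far has the target at that location). For an algorithm, the search time $S_d(n,f)$ is the worst-case completion time over both positions $\pm d$ of the target, all choices of at most $f$ faulty robots, and all behaviours of the faulty robots. The inequality $S_d(n,f)\le cd$ means that there is an algorithm, not depending on $d$, with search time at most $cd$ for every $d>0$. Asymptotic ratio. For non-integer $n$, $S_d(n,f)$ means $S_d(\lceil n\rceil,f)$ ($f$ is always an integer). For a density $\beta=f/n>0$ of faulty robots, $$\hat S(\beta)=\min\{\alpha \mid \exists \text{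 a constant } c_\beta \text{ such that for all integers } f>0,\ S_d(f/\beta+c_\beta,f)\le \alpha d\}.$$ -}

module Defs where

open import Algebra.Bundles using (CommutativeRing)
import Algebra.Construct.NaturalChoice.Max as Max
import Algebra.Definitions.RawMonoid as RawMonoidDefs
open import Data.Fin.Base using (Fin)
open import Data.Fin.Subset using (Subset; _∉_) renaming (∣_∣ to #_)
open import Data.Nat.Base as ℕ using (ℕ)
open import Data.Product.Base using (_×_; _,_; ∃; Σ-syntax; ∃-syntax)
open import Data.Sum.Base using (_⊎_)
open import Function.Bundles using (_⇔_)
open import Level using (0ℓ)
open import Relation.Binary.Bundles using (TotalOrder)
open import Relation.Binary.Core using (Rel)
import Relation.Binary.Construct.NonStrictToStrict as ToStrict
open import Relation.Binary.Structures using (IsTotalOrder)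
open import Relation.Nullary.Negation.Core using (¬_)
open import Relation.Unary using (Pred; _∈_)

-- The axioms characterising the real numbers, classically unique up to
-- isomorphism.

record CompleteOrderedField : Set₁ where
  infix  8 _⁻¹
  infixl 7 _/_
  infix  4 _≤_

  field
    commutativeRing : CommutativeRing 0ℓ 0ℓ

  open CommutativeRing commutativeRing public renaming (Carrier to ℝ)

  field
    _≤_          : Rel ℝ 0ℓ
    isTotalOrder : IsTotalOrder _≈_ _≤_
    +-monoʳ-≤    : ∀ x {y z} → y ≤ z → x + y ≤ x + z
    *-nonNeg     : ∀ {x y} → 0# ≤ x → 0# ≤ y → 0# ≤ x * y
    0≉1          : ¬ 0# ≈ 1#
    -- The value of 0# ⁻¹ is unspecified.
    _⁻¹          : ℝ → ℝ
    *-inverseʳ   : ∀ {x} → ¬ x ≈ 0# → x * x ⁻¹ ≈ 1#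

  UpperBound : Pred ℝ 0ℓ → Pred ℝ 0ℓ
  UpperBound P u = ∀ x → x ∈ P → x ≤ u

  field
    supremum : ∀ (P : Pred ℝ 0ℓ) → ∃ P → ∃ (UpperBound P) →
               ∃[ s ] (UpperBound P s × (∀ u → UpperBound P u → s ≤ u))

  totalOrder : TotalOrder 0ℓ 0ℓ 0ℓ
  totalOrder = record { isTotalOrder = isTotalOrder }

  open ToStrict _≈_ _≤_ public using (_<_)
  open Max totalOrder public using (_⊔_)

  _/_ : ℝ → ℝ → ℝ
  x / y = x * y ⁻¹

  ∣_∣ : ℝ → ℝ
  ∣ x ∣ = x ⊔ (- x)

  fromℕ : ℕ → ℝ
  fromℕ n = n · 1#
    where open RawMonoidDefs +-rawMonoid renaming (_×_ to _·_)

  infix 4 ⌈_⌉≈_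

  ⌈_⌉≈_ : ℝ → ℕ → Set
  ⌈ x ⌉≈ n = x ≤ fromℕ n × fromℕ n < x + 1#

module LineSearch (R : CompleteOrderedField) where

  open CompleteOrderedField R

  -- Only the times t with 0# ≤ t are meaningful.

  record Trajectory : Set where
    field
      at      : ℝ → ℝ
      at-cong : ∀ {s t} → s ≈ t → at s ≈ at t
      start   : at 0# ≈ 0#
      speed≤1 : ∀ {s t} → 0# ≤ s → s ≤ t → ∣ at t - at s ∣ ≤ t - s

  open Trajectory public

  -- Sent i x t : robot i, located at x, announces at time t that the target
  -- is at x.  The sender and its location are part of the message and are not
  -- subject to forgery; see Scenario.history.

  record History (n : ℕ) : Set₁ where
    field
      Sent      : Fin n → ℝ → ℝ → Set
      Sent-resp : ∀ {i x y s t} → x ≈ y → s ≈ t → Sent i x s → Sent i y t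

  open History public

  AgreeOn : ∀ {n} → Pred ℝ 0ℓ → History n → History n → Set
  AgreeOn Times H H′ = ∀ i x s → s ∈ Times → Sent H i x s ⇔ Sent H′ i x s

  -- A deterministic search algorithm for n robots.  By causality, the
  -- position of a robot at time t depends only on the messages sent before t;
  -- by continuity, a message sent at time t cannot affect it anyway, but it
  -- can affect the motion immediately after t.

  record Algorithm (n : ℕ) : Set₁ where
    field
      plan   : History n → Fin n → Trajectory
      causal : ∀ {H H′ t} → 0# ≤ t → AgreeOn (_< t) H H′ →
               ∀ i → at (plan H i) t ≈ at (plan H′ i) t

  open Algorithm public

  FirstVisit : Trajectory → ℝ → ℝ → Set
  FirstVisit γ x t =
    0# ≤ t × at γ t ≈ x × (∀ s → 0# ≤ s → s < t → ¬ at γ s ≈ x)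

  -- One complete execution of an algorithm with at most f faulty robots.
  -- Faulty robots move (with speed at most 1) and announce arbitrarily.
  --
  -- A reliable robot announces the target exactly when it first visits it.
  -- Were it required to announce during every visit, some algorithms would
  -- have no execution at all for some targets: if a robot is to be at the
  -- target at time 1 + 2⁻ᵏ exactly when there was no announcement in
  -- (1 , 1 + 2⁻ᵏ), for every k, then no set of announcements is consistent
  -- (Yablo's paradox), and such an algorithm would be vacuously correct.

  record Scenario {n : ℕ} (A : Algorithm n) (f : ℕ) : Set₁ where
    field
      target         : ℝ
      target≉0       : ¬ target ≈ 0#
      faulty         : Subset n
      #faulty≤f      : # faulty ℕ.≤ f
      motion         : Fin n → Trajectory
      Announces      : Fin n → ℝ → Set
      Announces-resp : ∀ {i s t} → s ≈ t → Announces i s → Announces i t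
      announce-time  : ∀ {i t} → Announces i t → 0# ≤ t

    history : History n
    history = record
      { Sent      = λ i x t → Announces i t × x ≈ at (motion i) t
      ; Sent-resp = λ {i} x≈y s≈t (a , x≈p) →
          Announces-resp s≈t a ,
          trans (sym x≈y) (trans x≈p (at-cong (motion i) s≈t))
      }

    Reliable : Fin n → Set
    Reliable i = i ∉ faulty

    field
      reliable-motion : ∀ {i} → Reliable i → ∀ t → 0# ≤ t →
                        at (motion i) t ≈ at (plan A history i) t
      reliable-report : ∀ {i} → Reliable i → ∀ t →
                        Announces i t ⇔ FirstVisit (motion i) target t

  open Scenario public

  -- At time T the target is determined by the messages sent up to T.

  Certain : ∀ {n} {A : Algorithm n} {f} → Scenario A f → ℝ → Set₁
  Certain {A = A} {f} E T =
    ∀ (E′ : Scenario A f) → AgreeOn (_≤ T) (history E) (history E′) →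
    target E′ ≈ target E

  Completed : ∀ {n} {A : Algorithm n} {f} → Scenario A f → ℝ → Set₁
  Completed E T =
    (∃[ i ] ∃[ t ] (Reliable E i × t ≤ T ×
                    at (motion E i) t ≈ target E × Announces E i t))
    × Certain E T

  -- SearchTime≤ n f c  is  S_d(n,f) ≤ c d : one algorithm serves all d.

  SearchTime≤ : ℕ → ℕ → ℝ → Set₁
  SearchTime≤ n f c =
    Σ[ A ∈ Algorithm n ] (∀ d → 0# < d → ∀ (E : Scenario A f) →
      target E ≈ d ⊎ target E ≈ - d →
      ∃[ T ] (T ≤ c * d × Completed E T))

  -- The set whose minimum is Ŝ(β).

  Achievable : ℝ → ℝ → Set₁
  Achievable β α =
    ∃[ c ] (∀ f → 0 ℕ.< f →
      ∃[ n ] ((⌈ fromℕ f / β + c ⌉≈ n) × SearchTime≤ n f α))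

  -- A minimum is at most a exactly when some element of the set is; stated
  -- this way, the inequality does not presuppose that the minimum exists.

  infix 4 Ŝ[_]≤_

  Ŝ[_]≤_ : ℝ → ℝ → Set₁
  Ŝ[ β ]≤ a = ∃[ α ] (α ≤ a × Achievable β α)

module Submission where

open import Defs
open import Algebra.Bundles using (RawRing)
import Algebra.Construct.NaturalChoice.Max as Max
import Algebra.Construct.NaturalChoice.MaxOp as MaxOp
import Algebra.Properties.AbelianGroup as AbelianGroupProperties
import Algebra.Properties.Ring as RingProperties
import Algebra.Properties.Semiring.Mult as SemiringMult
import Algebra.Solver.Ring as RingSolver
open import Algebra.Solver.Ring.AlmostCommutativeRing
  using (_-Raw-AlmostCommutative⟶_; fromCommutativeRing; Induced-equivalence)
import Algebra.Solver.Ring.NaturalCoefficients.Default as SemiringSolver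
open import Axiom.ExcludedMiddle using (ExcludedMiddle)
open import Data.Bool.Base using (Bool; true; false; not; if_then_else_)
open import Data.Bool.Properties using (not-¬; ¬-not; not-involutive; _≟_)
open import Data.Fin.Base using (Fin; zero; suc)
open import Data.Fin.Subset using (Subset; _∈_; _∉_; _∪_; ∁; ⊥; ⊤) renaming (∣_∣ to #_)
open import Data.Fin.Subset.Properties
  using (drop-there; p⊆q⇒∣p∣≤∣q∣; x∈p∪q⁻; x∈p∪q⁺; x∈∁p⇒x∉p; ∉⊥; ∣⊥∣≡0; ∣⊤∣≡n; ∣∁p∣≡n∸∣p∣)
open import Data.Maybe.Base using (just; nothing)
open import Data.Nat.Base as ℕ using (ℕ; zero; suc)
import Data.Nat.DivMod as ℕ
import Data.Nat.Properties as ℕ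
open import Data.Nat.Solver using (module +-*-Solver)
open import Data.Product.Base using (_×_; _,_; ∃; ∃-syntax; proj₁; proj₂)
open import Data.Sum.Base as Sum using (_⊎_; inj₁; inj₂; [_,_]′)
open import Data.Vec.Base using ([]; _∷_; here; there; lookup; tabulate)
open import Data.Vec.Properties using (lookup∘tabulate; lookup⇒[]=; []=⇒lookup; tabulate-cong)
open import Function.Base using (_∘_; _$_; id)
open import Function.Bundles using (_⇔_; mk⇔; Equivalence)
open import Level using (0ℓ)
open import Relation.Binary.Bundles using (Poset; TotalOrder)
import Relation.Binary.Construct.NonStrictToStrict as ToStrict
open import Relation.Binary.Definitions using (WeaklyDecidable)
import Relation.Binary.Properties.Poset as PosetProperties
open import Relation.Binary.PropositionalEquality.Core as ≡ using (_≡_; _≢_)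
import Relation.Binary.Reasoning.PartialOrder as PosetReasoning
import Relation.Binary.Reasoning.Setoid as SetoidReasoning
open import Relation.Nullary.Decidable using (Dec; yes; no; does; dec-true; dec-false; does-⇔)
open import Relation.Nullary.Negation.Core using (¬_; contradiction)
open import Relation.Unary using (Pred)

-- Half of the robots search the left half-line and half the right one, at full
-- speed.  When so many robots announce the target at distance x that neither
-- these announcers nor the silent robots are certainly faulty, all announcers
-- and part of the other robots cross to the mirror point while the rest wait, a
-- detour of length 2x.  If the target is at one of the two points, then enough
-- robots visit it to certify it.  Otherwise all the announcers are faulty, and
-- the search resumes against fewer faults; by the choice of the crossing robots
-- the margin |side| - (remaining faults) has grown by the factor 3/2.  With
-- fewer than r detours the target at distance d is thus reached after time at
-- most (2r + 1) d, and after r of them a simple majority decides at once.  With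
-- margins 4m, 6m, 9m this needs 4m + 6m + 9m = 19m > f and n ≥ 2 (f + 4m); with
-- 8m, 12m, 18m, 27m it needs 65m > f and n ≥ 2 (f + 8m).  That the answer is
-- certain is seen by comparing two executions with the same messages: the
-- robots discarded so far are faulty in both, and so few faults remain that
-- some robot that announced the target is reliable in both.

-- Ordered fields: a ring solver over the abstract reals, and linear inequalities.

module OrderedField (R : CompleteOrderedField) where

  open CompleteOrderedField R
  open RingProperties ring
  open AbelianGroupProperties +-abelianGroup using (⁻¹-∙-comm)
  open SemiringMult semiring using (×-homo-+; ×1-homo-*)
  open SetoidReasoning setoid

  -- Integer coefficients, as formal differences: the equality of ℝ is not
  -- decidable by computation, so the solver needs a coefficient ring of its own.

  private
    reduce : ℕ × ℕ → ℕ × ℕ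
    reduce (a , b) = a ℕ.∸ b , b ℕ.∸ a

    Difference : RawRing 0ℓ 0ℓ
    Difference = record
      { Carrier = ℕ × ℕ
      ; _≈_     = λ (a , b) (c , d) → a ℕ.+ d ≡ c ℕ.+ b
      ; _+_     = λ (a , b) (c , d) → reduce (a ℕ.+ c , b ℕ.+ d)
      ; _*_     = λ (a , b) (c , d) → reduce (a ℕ.* c ℕ.+ b ℕ.* d , a ℕ.* d ℕ.+ b ℕ.* c)
      ; -_      = λ (a , b) → b , a
      ; 0#      = 0 , 0
      ; 1#      = 1 , 0
      }

    difference : ℕ × ℕ → ℝ
    difference (a , b) = fromℕ a - fromℕ b

  fromℕ-+ : ∀ m n → fromℕ (m ℕ.+ n) ≈ fromℕ m + fromℕ n
  fromℕ-+ = ×-homo-+ 1#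

  fromℕ-* : ∀ m n → fromℕ (m ℕ.* n) ≈ fromℕ m * fromℕ n
  fromℕ-* = ×1-homo-*

  private
    open SemiringSolver commutativeSemiring using () renaming (solve to solve′; _:+_ to _⊕_; _:*_
      to _⊛_; _:=_ to _⊜_)

    interchange : ∀ a b c d → (a + c) - (b + d) ≈ (a - b) + (c - d)
    interchange a b c d = begin
      (a + c) - (b + d)      ≈⟨ +-congˡ (⁻¹-∙-comm b d) ⟨
      (a + c) + (- b + - d)  ≈⟨ solve′ 4 (λ a b c d → (a ⊕ c) ⊕ (b ⊕ d) ⊜ (a ⊕ b) ⊕ (c ⊕ d)) refl
        a (- b) c (- d) ⟩
      (a - b) + (c - d)      ∎

    expand : ∀ a b c d → (a * c + b * d) - (a * d + b * c) ≈ (a - b) * (c - d)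
    expand a b c d = begin
      (a * c + b * d) - (a * d + b * c)
        ≈⟨ +-cong (+-congˡ (-x*-y≈x*y b d)) (⁻¹-∙-comm _ _) ⟨
      (a * c + - b * - d) + (- (a * d) + - (b * c))
        ≈⟨ +-congˡ (+-cong (-‿distribʳ-* a d) (-‿distribˡ-* b c)) ⟩
      (a * c + - b * - d) + (a * - d + - b * c)
        ≈⟨ solve′ 4 (λ a b c d → (a ⊛ c ⊕ b ⊛ d) ⊕ (a ⊛ d ⊕ b ⊛ c) ⊜ (a ⊕ b) ⊛ (c ⊕ d)) refl a
          (- b) c (- d) ⟩
      (a - b) * (c - d) ∎
      where
      -x*-y≈x*y : ∀ x y → - x * - y ≈ x * y
      -x*-y≈x*y x y = begin
        - x * - y    ≈⟨ -‿distribˡ-* x (- y) ⟨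
        - (x * - y)  ≈⟨ -‿cong (-‿distribʳ-* x y) ⟨
        - - (x * y)  ≈⟨ -‿involutive (x * y) ⟩
        x * y        ∎

    transpose : ∀ {a b c d} → a + d ≈ c + b → a - b ≈ c - d
    transpose {a} {b} {c} {d} eq = begin
      a - b              ≈⟨ +-congʳ (+-identityʳ a) ⟨
      a + 0# - b         ≈⟨ +-congʳ (+-congˡ (-‿inverseʳ d)) ⟨
      a + (d - d) - b    ≈⟨ solve′ 4 (λ a d d′ b′ → (a ⊕ (d ⊕ d′)) ⊕ b′ ⊜ (a ⊕ d) ⊕ (d′ ⊕ b′))
        refl a d (- d) (- b) ⟩
      a + d + (- d - b)  ≈⟨ +-congʳ eq ⟩
      c + b + (- d - b)  ≈⟨ solve′ 4 (λ c b d′ b′ → (c ⊕ b) ⊕ (d′ ⊕ b′) ⊜ (c ⊕ d′) ⊕ (b ⊕ b′))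
        refl c b (- d) (- b) ⟩
      c - d + (b - b)    ≈⟨ +-congˡ (-‿inverseʳ b) ⟩
      c - d + 0#         ≈⟨ +-identityʳ (c - d) ⟩
      c - d              ∎

    fromℕ-transpose : ∀ a b c d → a ℕ.+ d ≡ c ℕ.+ b → difference (a , b) ≈ difference (c , d)
    fromℕ-transpose a b c d eq = transpose (begin
      fromℕ a + fromℕ d  ≈⟨ fromℕ-+ a d ⟨
      fromℕ (a ℕ.+ d)    ≡⟨ ≡.cong fromℕ eq ⟩
      fromℕ (c ℕ.+ b)    ≈⟨ fromℕ-+ c b ⟩
      fromℕ c + fromℕ b  ∎)

    difference-reduce : ∀ p → difference (reduce p) ≈ difference p
    difference-reduce (a , b) = fromℕ-transpose (a ℕ.∸ b) (b ℕ.∸ a) a b (∸-swap a b)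
      where
      ∸-swap : ∀ a b → a ℕ.∸ b ℕ.+ b ≡ a ℕ.+ (b ℕ.∸ a)
      ∸-swap zero    zero    = ≡.refl
      ∸-swap zero    (suc b) = ≡.refl
      ∸-swap (suc a) zero    = ≡.refl
      ∸-swap (suc a) (suc b) = ≡.trans (ℕ.+-suc (a ℕ.∸ b) b) (≡.cong suc (∸-swap a b))

    morphism : Difference -Raw-AlmostCommutative⟶ fromCommutativeRing commutativeRing
    morphism = record
      { ⟦_⟧    = difference
      ; +-homo = λ (a , b) (c , d) → trans (difference-reduce (a ℕ.+ c , b ℕ.+ d)) $
          trans (+-cong (fromℕ-+ a c) (-‿cong (fromℕ-+ b d)))
                (interchange (fromℕ a) (fromℕ b) (fromℕ c) (fromℕ d))
      ; *-homo = λ (a , b) (c , d) → trans (difference-reduce (a ℕ.* c ℕ.+ b ℕ.* d , a ℕ.* d ℕ.+ b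
            ℕ.* c)) $
          trans (+-cong (trans (fromℕ-+ (a ℕ.* c) (b ℕ.* d)) (+-cong (fromℕ-* a c) (fromℕ-* b d)))
                        (-‿cong (trans (fromℕ-+ (a ℕ.* d) (b ℕ.* c)) (+-cong (fromℕ-* a d)
                          (fromℕ-* b c)))))
                (expand (fromℕ a) (fromℕ b) (fromℕ c) (fromℕ d))
      ; -‿homo = λ (a , b) → begin
          fromℕ b - fromℕ a        ≈⟨ +-comm _ _ ⟩
          - fromℕ a + fromℕ b      ≈⟨ +-congˡ (-‿involutive (fromℕ b)) ⟨
          - fromℕ a + - - fromℕ b  ≈⟨ ⁻¹-∙-comm _ _ ⟩
          - (fromℕ a - fromℕ b)    ∎
      ; 0-homo = -‿inverseʳ 0#
      ; 1-homo = begin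
          (1# + 0#) - 0#  ≈⟨ +-congʳ (+-identityʳ 1#) ⟩
          1# - 0#         ≈⟨ +-congˡ -0#≈0# ⟩
          1# + 0#         ≈⟨ +-identityʳ 1# ⟩
          1#              ∎
      }

    -- Formal differences are compared in ℕ. Only a positive answer transfers to `ℝ`, and that is
    -- all the solver asks for.
    _≟ᶜ_ : WeaklyDecidable (Induced-equivalence morphism)
    (a , b) ≟ᶜ (c , d) with a ℕ.+ d ℕ.≟ c ℕ.+ b
    ... | no  _  = nothing
    ... | yes eq = just (fromℕ-transpose a b c d eq)

  open RingSolver Difference (fromCommutativeRing commutativeRing) morphism _≟ᶜ_
    public using (solve; _:=_; _:+_; _:*_; _:-_; :-_)

  poset : Poset 0ℓ 0ℓ 0ℓ
  poset = TotalOrder.poset totalOrder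

  open TotalOrder totalOrder public
    using (total; antisym; ≤-respˡ-≈; ≤-respʳ-≈)
    renaming (refl to ≤-refl; reflexive to ≤-reflexive; trans to ≤-trans)

  open PosetProperties poset public
    using (<-trans; <⇒≱; <-respˡ-≈; <-respʳ-≈)

  <⇒≤ : ∀ {x y} → x < y → x ≤ y
  <⇒≤ = proj₁

  ≰⇒> : ∀ {x y} → ¬ x ≤ y → y < x
  ≰⇒> = ToStrict.≰⇒> _≈_ _≤_ sym ≤-reflexive total

  ≤-<-trans : ∀ {x y z} → x ≤ y → y < z → x < z
  ≤-<-trans = ToStrict.≤-<-trans _≈_ _≤_ ≤-trans antisym ≤-respˡ-≈

  <-≤-trans : ∀ {x y z} → x < y → y ≤ z → x < z
  <-≤-trans = ToStrict.<-≤-trans _≈_ _≤_ sym ≤-trans antisym ≤-respʳ-≈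

  -- The linear inequalities below are obtained by exhibiting b - a as the
  -- slack d - c of a (sum of) known ones.

  ≤-shift : ∀ {a b c d} → c ≤ d → b - a ≈ d - c → a ≤ b
  ≤-shift {a} {b} {c} {d} c≤d eq =
    ≤-respˡ-≈ (solve 2 (λ a c → (a :- c) :+ c := a) refl a c) $
    ≤-respʳ-≈ (begin
      (a - c) + d        ≈⟨ solve 3 (λ a c d → (a :- c) :+ d := a :+ (d :- c)) refl a c d ⟩
      a + (d - c)        ≈⟨ +-congˡ eq ⟨
      a + (b - a)        ≈⟨ solve 2 (λ a b → a :+ (b :- a) := b) refl a b ⟩
      b                  ∎) $
    +-monoʳ-≤ (a - c) c≤d

  <-shift : ∀ {a b c d} → c < d → b - a ≈ d - c → a < b
  <-shift {a} {b} {c} {d} (c≤d , c≉d) eq = ≤-shift c≤d eq , λ a≈b → c≉d (begin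
    c                ≈⟨ solve 2 (λ a c → c := c :+ (a :- a)) refl a c ⟩
    c + (a - a)      ≈⟨ +-congˡ (+-congʳ a≈b) ⟩
    c + (b - a)      ≈⟨ +-congˡ eq ⟩
    c + (d - c)      ≈⟨ solve 2 (λ c d → c :+ (d :- c) := d) refl c d ⟩
    d                ∎)

  +-mono-≤ : ∀ {a b c d} → a ≤ b → c ≤ d → a + c ≤ b + d
  +-mono-≤ {a} {b} {c} {d} a≤b c≤d = ≤-trans (+-monoʳ-≤ a c≤d)
    (≤-shift a≤b (solve 3 (λ a b d → (b :+ d) :- (a :+ d) := b :- a) refl a b d))

  +-mono-<-≤ : ∀ {a b c d} → a < b → c ≤ d → a + c < b + d
  +-mono-<-≤ {a} {b} {c} {d} a<b c≤d = ≤-<-trans (+-monoʳ-≤ a c≤d)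
    (<-shift a<b (solve 3 (λ a b d → (b :+ d) :- (a :+ d) := b :- a) refl a b d))

-- Counting finite sets of robots, and the balance of a crossing.

module Counting where

  open import Data.Nat.Base using (_+_; _∸_; _⊔_; _≤_; z≤n; s≤s)
  open import Data.Nat.Properties hiding (_≟_)
  open +-*-Solver using (solve; _:=_; _:+_)
  open ≡ using (refl; sym; trans; cong; subst; subst₂)

  -- The counterpart of `≤-shift` in ℕ: the slacks b - a and d - c are compared by cross-addition,
  -- which avoids truncated subtraction.
  ≤-slack : ∀ {a b c d} → c ≤ d → a + d ≡ b + c → a ≤ b
  ≤-slack {a} {b} {c} {d} c≤d eq =
    +-cancelʳ-≤ d a b (≤-trans (≤-reflexive eq) (+-monoʳ-≤ b c≤d))

  -- A canonical choice, the members of least index, so that the crossing robots are determined by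
  -- the messages alone.
  take : ∀ {n} → Subset n → ℕ → Subset n
  take []          k       = []
  take (false ∷ p) k       = false ∷ take p k
  take (true ∷ p)  zero    = false ∷ take p zero
  take (true ∷ p)  (suc k) = true ∷ take p k

  take-⊆ : ∀ {n} (p : Subset n) k {i} → i ∈ take p k → i ∈ p
  take-⊆ (false ∷ p) k       (there i∈) = there (take-⊆ p k i∈)
  take-⊆ (true ∷ p)  zero    (there i∈) = there (take-⊆ p zero i∈)
  take-⊆ (true ∷ p)  (suc k) here       = here
  take-⊆ (true ∷ p)  (suc k) (there i∈) = there (take-⊆ p k i∈)

  #-take : ∀ {n} (p : Subset n) {k} → k ≤ # p → # take p k ≡ k
  #-take []          z≤n       = refl
  #-take (false ∷ p) k≤        = #-take p k≤
  #-take (true ∷ p)  {zero}  _ = #-take p z≤n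
  #-take (true ∷ p)  {suc k} k≤ = cong suc (#-take p (≤-pred k≤))

  private
    bit : Bool → ℕ
    bit b = if b then 1 else 0

    #-∷ : ∀ {n} b (p : Subset n) → # (b ∷ p) ≡ bit b + # p
    #-∷ true  p = refl
    #-∷ false p = refl

  -- An index counts at most once on the left, by disjointness, and then at least once on the right.
  -- The other counting lemmas are instances of this one.
  #-cover : ∀ {n} (p q r s : Subset n) →
            (∀ {i} → i ∈ p → i ∉ q) →
            (∀ {i} → i ∈ p ⊎ i ∈ q → i ∈ r ⊎ i ∈ s) →
            # p + # q ≤ # r + # s
  #-cover [] [] [] [] _ _ = z≤n
  #-cover (a ∷ p) (b ∷ q) (c ∷ r) (d ∷ s) disjoint covered
    rewrite #-∷ a p | #-∷ b q | #-∷ c r | #-∷ d s =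
    subst₂ _≤_ (interchange (bit a) (bit b) (# p) (# q)) (interchange (bit c) (bit d) (# r) (# s))
      $
    +-mono-≤ (heads a b c d (λ { refl refl → disjoint here here })
                            (λ { refl → head (covered (inj₁ here)) })
                            (λ { refl → head (covered (inj₂ here)) }))
             (#-cover p q r s (λ i∈p i∈q → disjoint (there i∈p) (there i∈q))
                              (tail ∘ covered ∘ [ inj₁ ∘ there , inj₂ ∘ there ]′))
    where
    interchange : ∀ a b x y → (a + b) + (x + y) ≡ (a + x) + (b + y)
    interchange = solve 4 (λ a b x y → (a :+ b) :+ (x :+ y) := (a :+ x) :+ (b :+ y)) refl

    head : zero ∈ (c ∷ r) ⊎ zero ∈ (d ∷ s) → c ≡ true ⊎ d ≡ true
    head (inj₁ here) = inj₁ refl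
    head (inj₂ here) = inj₂ refl

    tail : ∀ {i} → suc i ∈ (c ∷ r) ⊎ suc i ∈ (d ∷ s) → i ∈ r ⊎ i ∈ s
    tail = [ inj₁ ∘ drop-there , inj₂ ∘ drop-there ]′

    heads : ∀ a b c d → (a ≡ true → ¬ b ≡ true) →
            (a ≡ true → c ≡ true ⊎ d ≡ true) → (b ≡ true → c ≡ true ⊎ d ≡ true) →
            bit a + bit b ≤ bit c + bit d
    heads false false c d _ _ _ = z≤n
    heads true  true  c d x _ _ = contradiction refl (x refl)
    heads true  false c d _ x _ with x refl
    ... | inj₁ refl = s≤s z≤n
    ... | inj₂ refl = m≤n+m 1 (bit c)
    heads false true  c d _ _ x with x refl
    ... | inj₁ refl = s≤s z≤n
    ... | inj₂ refl = m≤n+m 1 (bit c)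

  #-subadditive : ∀ {n} (p q r : Subset n) → (∀ {i} → i ∈ p → i ∈ q ⊎ i ∈ r) → # p ≤ # q + # r
  #-subadditive {n} p q r p⊆ = begin
    # p             ≡⟨ +-identityʳ (# p) ⟨
    # p + 0         ≡⟨ cong (# p +_) (∣⊥∣≡0 n) ⟨
    # p + # (⊥ {n}) ≤⟨ #-cover p ⊥ q r (λ _ → ∉⊥) [ p⊆ , (λ i∈ → contradiction i∈ ∉⊥) ]′ ⟩
    # q + # r       ∎
    where open ≤-Reasoning

  #-disjoint : ∀ {n} (p q r : Subset n) → (∀ {i} → i ∈ p → i ∉ q) →
               (∀ {i} → i ∈ p ⊎ i ∈ q → i ∈ r) → # p + # q ≤ # r
  #-disjoint {n} p q r disjoint ⊆r = begin
    # p + # q        ≤⟨ #-cover p q r ⊥ disjoint (inj₁ ∘ ⊆r) ⟩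
    # r + # (⊥ {n})  ≡⟨ cong (# r +_) (∣⊥∣≡0 n) ⟩
    # r + 0          ≡⟨ +-identityʳ (# r) ⟩
    # r              ∎
    where open ≤-Reasoning

  -- How many robots must cross from a side with a announcers, beside these, when
  -- there are k announcers altogether and g robots at large may be faulty.  The
  -- first term provides enough votes at the mirror point, the second one keeps the
  -- two sides balanced.

  quota : ℕ → ℕ → ℕ → ℕ → ℕ
  quota g h a k = (g + h ∸ a) ⊔ (g + (h + h) ∸ k)

  -- A side with m robots at large besides its announcers can supply the quota: m meets both of the
  -- constraints whose least solution the quota is.
  quota-≤ : ∀ g h {a k} m → g + (h + h) ≤ a + m → a ≤ k → quota g h a k ≤ m
  quota-≤ g h {a} {k} m enough a≤k = ⊔-lub
    (m≤n+o⇒m∸n≤o (g + h) a (≤-trans (+-monoʳ-≤ g (m≤m+n h h)) enough))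
    (m≤n+o⇒m∸n≤o (g + (h + h)) k (≤-trans enough (+-monoˡ-≤ m a≤k)))

  ≤quota₁ : ∀ g h a k → g + h ≤ a + quota g h a k
  ≤quota₁ g h a k = ≤-trans (m≤n+m∸n (g + h) a) (+-monoʳ-≤ a (m≤m⊔n _ _))

  ≤quota₂ : ∀ g h a k → g + (h + h) ≤ k + quota g h a k
  ≤quota₂ g h a k = ≤-trans (m≤n+m∸n (g + (h + h)) k) (+-monoʳ-≤ k (m≤n⊔m (g + h ∸ a) _))

  -- Write q for the quota of the other side. By minimality of the quota it suffices that y = b + q
  -- - h meets both of its constraints. The first one is the second constraint on q; the second one
  -- follows from the first constraint on q and from h + h ≤ a + b.
  quota-balanced : ∀ g h a b → h + h ≤ a + b →
                   quota g h a (a + b) + h ≤ b + quota g h b (a + b)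
  quota-balanced g h a b enough = begin
    quota g h a (a + b) + h  ≤⟨ +-monoˡ-≤ h (⊔-lub (m≤n+o⇒m∸n≤o (g + h) a first)
      (m≤n+o⇒m∸n≤o (g + (h + h)) (a + b) second)) ⟩
    y + h                    ≡⟨ m∸n+n≡m h≤ ⟩
    b + q                    ∎
    where
    open ≤-Reasoning
    q y : ℕ
    q = quota g h b (a + b)
    y = b + q ∸ h
    h≤ : h ≤ b + q
    h≤ = ≤-trans (m≤n+m h g) (≤quota₁ g h b (a + b))
    y+h≡b+q : y + h ≡ b + q
    y+h≡b+q = m∸n+n≡m h≤
    first : g + h ≤ a + y
    first = +-cancelʳ-≤ h _ _ (begin
      g + h + h      ≡⟨ +-assoc g h h ⟩
      g + (h + h)    ≤⟨ ≤quota₂ g h b (a + b) ⟩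
      a + b + q      ≡⟨ +-assoc a b q ⟩
      a + (b + q)    ≡⟨ cong (a +_) y+h≡b+q ⟨
      a + (y + h)    ≡⟨ +-assoc a y h ⟨
      a + y + h      ∎)
    second : g + (h + h) ≤ a + b + y
    second = +-cancelʳ-≤ h _ _ (begin
      g + (h + h) + h    ≡⟨ solve 2 (λ g h → g :+ (h :+ h) :+ h := h :+ h :+ (g :+ h)) refl g h ⟩
      h + h + (g + h)    ≤⟨ +-mono-≤ enough (≤quota₁ g h b (a + b)) ⟩
      a + b + (b + q)    ≡⟨ cong (a + b +_) y+h≡b+q ⟨
      a + b + (y + h)    ≡⟨ +-assoc (a + b) y h ⟨
      a + b + y + h      ∎)

  module Classical (em : ExcludedMiddle 0ℓ) where

    -- Excluded middle turns predicates into vectors of Booleans, which can be counted and compared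
    -- by `≡`.
    ⟦_⟧ : ∀ {n} → Pred (Fin n) 0ℓ → Subset n
    ⟦ Q ⟧ = tabulate (λ i → does (em {Q i}))

    ⟦⟧⁺ : ∀ {n} (Q : Pred (Fin n) 0ℓ) {i} → Q i → i ∈ ⟦ Q ⟧
    ⟦⟧⁺ Q {i} q = lookup⇒[]= i _ (trans (lookup∘tabulate _ i) (dec-true em q))

    ⟦⟧⁻ : ∀ {n} (Q : Pred (Fin n) 0ℓ) {i} → i ∈ ⟦ Q ⟧ → Q i
    ⟦⟧⁻ Q {i} i∈ with em {Q i} | trans (sym (lookup∘tabulate (λ j → does (em {Q j})) i))
      ([]=⇒lookup i∈)
    ... | yes q | _ = q

    ⟦⟧-cong : ∀ {n} {Q Q′ : Pred (Fin n) 0ℓ} → (∀ i → Q i ⇔ Q′ i) → ⟦ Q ⟧ ≡ ⟦ Q′ ⟧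
    ⟦⟧-cong eqv = tabulate-cong (λ i → does-⇔ (eqv i) em em)

    free : ∀ {n} → Subset n → Subset n → Bool → Subset n
    free P D b = ⟦ (λ i → lookup P i ≡ b × i ∉ D) ⟧

    -- A robot that stops being free is counted among the exposed ones instead. Exposing more robots
    -- therefore preserves the margin of a side over the remaining faults.
    free-∪ : ∀ {n} (P D D′ : Subset n) b → (∀ {i} → i ∈ D → i ∈ D′) →
             # free P D b + # D ≤ # free P D′ b + # D′
    free-∪ P D D′ b D⊆D′ = #-cover (free P D b) D (free P D′ b) D′
      (proj₂ ∘ ⟦⟧⁻ _)
      λ { (inj₁ i∈) → split (⟦⟧⁻ _ i∈) ; (inj₂ i∈D) → inj₂ (D⊆D′ i∈D) }
      where
      split : ∀ {i} → lookup P i ≡ b × i ∉ D → i ∈ free P D′ b ⊎ i ∈ D′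
      split {i} (eq , _) with em {i ∈ D′}
      ... | yes i∈ = inj₂ i∈
      ... | no  i∉ = inj₁ (⟦⟧⁺ _ (eq , i∉))

    -- One round: P is the set of robots on the right, D the known faulty ones
    -- and K the robots that announce the target.  All of K and quota many of the
    -- other robots at large cross to the opposite side.

    module Crossing {n} (f h : ℕ) (P D K : Subset n) where

      g : ℕ
      g = f ∸ # D

      announcers : Bool → Subset n
      announcers b = ⟦ (λ i → i ∈ K × lookup P i ≡ b) ⟧

      others : Bool → Subset n
      others b = ⟦ (λ i → i ∈ free P D b × i ∉ K) ⟧

      extras : Bool → Subset n
      extras b = take (others b) (quota g h (# announcers b) (# K))

      Crosses : Fin n → Set
      Crosses i = i ∈ K ⊎ i ∈ extras (lookup P i)

      regrouped : Subset n
      regrouped = tabulate (λ i → if does (em {Crosses i}) then not (lookup P i) else lookup P i)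

      crosses : ∀ {i} → Crosses i → lookup regrouped i ≡ not (lookup P i)
      crosses {i} c rewrite lookup∘tabulate (λ j → if does (em {Crosses j}) then not (lookup P j)
        else lookup P j) i
                          | dec-true (em {Crosses i}) c = refl

      stays : ∀ {i} → ¬ Crosses i → lookup regrouped i ≡ lookup P i
      stays {i} c rewrite lookup∘tabulate (λ j → if does (em {Crosses j}) then not (lookup P j)
        else lookup P j) i
                        | dec-false (em {Crosses i}) c = refl

      -- At a conflict these robots pass the point on side b: some are there when it starts, the
      -- others arrive by its end.
      visitors : Bool → Subset n
      visitors b = ⟦ (λ i → (lookup P i ≡ b ⊎ lookup regrouped i ≡ b) × i ∉ D) ⟧

      module _ (#D≤f : # D ≤ f) (K∉D : ∀ {i} → i ∈ K → i ∉ D) (1≤h : 1 ≤ h) (enough : h + h ≤ # K)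
               (sides : ∀ b → f + (h + h) ≤ # free P D b + # D) where

        private
          k p m : Bool → ℕ
          k b = # announcers b
          p b = quota g h (k b) (# K)
          m b = # others b

          g+#D≡f : g + # D ≡ f
          g+#D≡f = m∸n+n≡m #D≤f

          -- The hypothesis `sides` in terms of the g faults at large: each side has a margin of 2h
          -- over them.
          free≥ : ∀ b → g + (h + h) ≤ # free P D b
          free≥ b = ≤-slack (sides b) (trans
            (solve 4 (λ g h a d → g :+ h :+ (a :+ d) := a :+ (g :+ d :+ h)) refl g (h + h)
              (# free P D b) (# D))
            (cong (λ z → # free P D b + (z + (h + h))) g+#D≡f))

          #K≤ : ∀ b → # K ≤ k b + k (not b)
          #K≤ b = #-subadditive K (announcers b) (announcers (not b)) side
            where
            side : ∀ {i} → i ∈ K → i ∈ announcers b ⊎ i ∈ announcers (not b)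
            side {i} i∈K with lookup P i ≟ b
            ... | yes eq = inj₁ (⟦⟧⁺ _ (i∈K , eq))
            ... | no ¬eq = inj₂ (⟦⟧⁺ _ (i∈K , ¬-not ¬eq))

          #K≥ : ∀ b → k b + k (not b) ≤ # K
          #K≥ b = #-disjoint (announcers b) (announcers (not b)) K
            (λ i∈ i∈′ → not-¬ (proj₂ (⟦⟧⁻ _ i∈)) (proj₂ (⟦⟧⁻ _ i∈′)))
            [ proj₁ ∘ ⟦⟧⁻ _ , proj₁ ∘ ⟦⟧⁻ _ ]′

          #K≡ : ∀ b → # K ≡ k b + k (not b)
          #K≡ b = ≤-antisym (#K≤ b) (#K≥ b)

          free≤ : ∀ b → # free P D b ≤ k b + m b
          free≤ b = #-subadditive (free P D b) (announcers b) (others b) split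
            where
            split : ∀ {i} → i ∈ free P D b → i ∈ announcers b ⊎ i ∈ others b
            split {i} i∈ with em {i ∈ K}
            ... | yes i∈K = inj₁ (⟦⟧⁺ _ (i∈K , proj₁ (⟦⟧⁻ _ i∈)))
            ... | no  i∉K = inj₂ (⟦⟧⁺ _ (i∈ , i∉K))

          #extras : ∀ b → # extras b ≡ p b
          #extras b = #-take (others b)
            (quota-≤ g h (m b) (≤-trans (free≥ b) (free≤ b)) (≤-trans (m≤m+n _ _) (#K≥ b)))

          extras-side : ∀ b {i} → i ∈ extras b → lookup P i ≡ b
          extras-side b i∈ = proj₁ (⟦⟧⁻ _ (proj₁ (⟦⟧⁻ _ (take-⊆ (others b) _ i∈))))

          extra-crosses : ∀ b {i} → i ∈ extras b → Crosses i
          extra-crosses b i∈ = inj₂ (subst (λ c → _ ∈ extras c) (sym (extras-side b i∈)) i∈)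

          staying : Bool → Subset n
          staying b = ⟦ (λ i → i ∈ others b × i ∉ extras b) ⟧

          others≤ : ∀ b → m b ≤ # staying b + p b
          others≤ b = subst (λ z → m b ≤ # staying b + z) (#extras b)
            (#-subadditive (others b) (staying b) (extras b) split)
            where
            split : ∀ {i} → i ∈ others b → i ∈ staying b ⊎ i ∈ extras b
            split {i} i∈ with em {i ∈ extras b}
            ... | yes x = inj₂ x
            ... | no ¬x = inj₁ (⟦⟧⁺ _ (i∈ , ¬x))

          other∉ : ∀ b {i} → i ∈ others b → i ∉ D ∪ K
          other∉ b i∈ i∈D∪K with ⟦⟧⁻ _ i∈
          ... | i∈free , i∉K = [ proj₂ (⟦⟧⁻ _ i∈free) , i∉K ]′ (x∈p∪q⁻ D K i∈D∪K)

          -- All announcers become suspects, so the robots at large on side b are those that stay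
          -- there and the extras coming from the other side.
          new-free≥ : ∀ b → # staying b + p (not b) ≤ # free regrouped (D ∪ K) b
          new-free≥ b = subst (λ z → # staying b + z ≤ # free regrouped (D ∪ K) b)
            (#extras (not b))
            (#-disjoint (staying b) (extras (not b)) (free regrouped (D ∪ K) b)
              (λ i∈ i∈′ → not-¬ (staying-side i∈) (extras-side (not b) i∈′))
              [ stayer , crosser ]′)
            where
            staying-side : ∀ {i} → i ∈ staying b → lookup P i ≡ b
            staying-side i∈ = proj₁ (⟦⟧⁻ _ (proj₁ (⟦⟧⁻ _ (proj₁ (⟦⟧⁻ _ i∈)))))
            stayer : ∀ {i} → i ∈ staying b → i ∈ free regrouped (D ∪ K) b
            stayer {i} i∈ with ⟦⟧⁻ _ i∈
            ... | i∈others , i∉extras = ⟦⟧⁺ _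
              ( trans (stays [ proj₂ (⟦⟧⁻ _ i∈others)
                             , (λ x → i∉extras (subst (λ c → i ∈ extras c) (staying-side i∈) x))
                                   ]′)
                      (staying-side i∈)
              , other∉ b i∈others)
            crosser : ∀ {i} → i ∈ extras (not b) → i ∈ free regrouped (D ∪ K) b
            crosser i∈ = ⟦⟧⁺ _
              ( trans (crosses (extra-crosses (not b) i∈))
                      (trans (cong not (extras-side (not b) i∈)) (not-involutive b))
              , other∉ (not b) (take-⊆ (others (not b)) _ i∈))

        #D+#K≤ : # D + # K ≤ # (D ∪ K)
        #D+#K≤ = #-disjoint D K (D ∪ K) (λ i∈D i∈K → K∉D i∈K i∈D) x∈p∪q⁺

        -- The margin grows from 2h to 3h. Side b loses `k b` announcers and `p b` extras and gains
        -- `p (not b)` extras, while `k b + k (not b)` robots are exposed. The net gain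
        -- `k (not b) + p (not b) - p b` is at least h by `quota-balanced`.
        balanced : ∀ b → f + (h + h + h) ≤ # free regrouped (D ∪ K) b + # (D ∪ K)
        balanced b = +-cancelʳ-≤ (p b) _ _ (begin
          f + (h + h + h) + p b
            ≡⟨ solve 3 (λ f h p → f :+ (h :+ h :+ h) :+ p := f :+ (h :+ h) :+ (p :+ h)) refl f h
              (p b) ⟩
          f + (h + h) + (p b + h)
            ≤⟨ +-mono-≤ (sides b) (subst (λ z → quota g h (k b) z + h ≤ k (not b) + quota g h
              (k (not b)) z) (sym (#K≡ b)) (quota-balanced g h (k b) (k (not b)) (subst (h + h ≤_)
              (#K≡ b) enough))) ⟩
          # free P D b + # D + (k (not b) + p (not b))
            ≤⟨ +-monoˡ-≤ _ (+-monoˡ-≤ (# D) (≤-trans (free≤ b) (+-monoʳ-≤ (k b) (others≤ b)))) ⟩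
          k b + (# staying b + p b) + # D + (k (not b) + p (not b))
            ≡⟨ solve 6 (λ k s p d k′ p′ → k :+ (s :+ p) :+ d :+ (k′ :+ p′) := s :+ p′
              :+ (d :+ (k :+ k′)) :+ p) refl
                 (k b) (# staying b) (p b) (# D) (k (not b)) (p (not b)) ⟩
          # staying b + p (not b) + (# D + (k b + k (not b))) + p b
            ≤⟨ +-monoˡ-≤ (p b) (+-mono-≤ (new-free≥ b) (≤-trans (+-monoʳ-≤ (# D) (#K≥ b))
              #D+#K≤)) ⟩
          # free regrouped (D ∪ K) b + # (D ∪ K) + p b ∎)
          where open ≤-Reasoning

        -- In terms of g this says that more than 2g robots at large visit the point: at least g +
        -- 2h are on its side, and at least g + h arrive, by the first term of the quota. More than
        -- g of them are then reliable.
        visited : ∀ b → suc (f + f) ≤ # visitors b + (# D + # D)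
        visited b = begin
          suc (f + f)
            ≤⟨ +-monoˡ-≤ (f + f) 1≤h ⟩
          h + (f + f)
            ≤⟨ m≤n+m _ (h + h) ⟩
          h + h + (h + (f + f))
            ≡⟨ solve 2 (λ f h → h :+ h :+ (h :+ (f :+ f)) := f :+ (h :+ h) :+ (f :+ h)) refl f h ⟩
          f + (h + h) + (f + h)
            ≡⟨ cong (λ z → f + (h + h) + (z + h)) g+#D≡f ⟨
          f + (h + h) + (g + # D + h)
            ≡⟨ solve 4 (λ f h g d → f :+ (h :+ h) :+ (g :+ d :+ h) := f :+ (h :+ h) :+ (g :+ h)
              :+ d) refl f h g (# D) ⟩
          f + (h + h) + (g + h) + # D
            ≤⟨ +-monoˡ-≤ (# D) (+-mono-≤ (sides b) (≤quota₁ g h (k (not b)) (# K))) ⟩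
          # free P D b + # D + (k (not b) + p (not b)) + # D
            ≤⟨ +-monoˡ-≤ (# D) (+-monoʳ-≤ _ arriving≥) ⟩
          # free P D b + # D + # arriving + # D
            ≡⟨ solve 3 (λ a d x → a :+ d :+ x :+ d := a :+ x :+ (d :+ d)) refl (# free P D b)
              (# D) (# arriving) ⟩
          # free P D b + # arriving + (# D + # D)
            ≤⟨ +-monoˡ-≤ _ (#-disjoint (free P D b) arriving (visitors b)
                 (λ i∈ i∈′ → not-¬ (proj₁ (⟦⟧⁻ _ i∈)) (proj₁ (⟦⟧⁻ _ i∈′)))
                 [ (λ i∈ → ⟦⟧⁺ _ (inj₁ (proj₁ (⟦⟧⁻ _ i∈)) , proj₂ (⟦⟧⁻ _ i∈))) , arrive ]′) ⟩
          # visitors b + (# D + # D) ∎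
          where
          open ≤-Reasoning
          arriving : Subset n
          arriving = ⟦ (λ i → lookup P i ≡ not b × i ∉ D × Crosses i) ⟧
          arriving≥ : k (not b) + p (not b) ≤ # arriving
          arriving≥ = subst (λ z → k (not b) + z ≤ # arriving) (#extras (not b))
            (#-disjoint (announcers (not b)) (extras (not b)) arriving
              (λ i∈ i∈′ → proj₂ (⟦⟧⁻ _ (take-⊆ (others (not b)) _ i∈′)) (proj₁ (⟦⟧⁻ _ i∈)))
              [ (λ i∈ → let i∈K , eq = ⟦⟧⁻ _ i∈ in ⟦⟧⁺ _ (eq , K∉D i∈K , inj₁ i∈K))
              , (λ i∈ → ⟦⟧⁺ _ ( extras-side (not b) i∈
                              , other∉ (not b) (take-⊆ (others (not b)) _ i∈) ∘ x∈p∪q⁺ ∘ inj₁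
                              , extra-crosses (not b) i∈)) ]′)
          arrive : ∀ {i} → i ∈ arriving → i ∈ visitors b
          arrive i∈ with ⟦⟧⁻ _ i∈
          ... | eq , i∉D , c = ⟦⟧⁺ _
                (inj₂ (trans (crosses c) (trans (cong not eq) (not-involutive b))) , i∉D)

open Counting using (take; #-take; #-cover; #-disjoint; module Classical)

-- Signed distances, and gluing paths of speed at most 1.

module Motion (em : ExcludedMiddle 0ℓ) (R : CompleteOrderedField) where

  open CompleteOrderedField R hiding (zero)
  open OrderedField R
  open LineSearch R
  open RingProperties ring using (-‿injective; -‿involutive; -0#≈0#)

  signed : Bool → ℝ → ℝ
  signed true  z = z
  signed false z = - z

  signed-cong : ∀ {b c y z} → b ≡ c → y ≈ z → signed b y ≈ signed c z
  signed-cong {true}  ≡.refl y≈z = y≈z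
  signed-cong {false} ≡.refl y≈z = -‿cong y≈z

  signed-not : ∀ b z → signed (not b) (- z) ≈ signed b z
  signed-not true  z = -‿involutive z
  signed-not false z = refl

  signed-injective : ∀ b c {y z} → signed b y ≈ signed c z → (b ≡ c × y ≈ z) ⊎ y ≈ - z
  signed-injective true  true  eq = inj₁ (≡.refl , eq)
  signed-injective true  false eq = inj₂ eq
  signed-injective false true  eq = inj₂ (trans (sym (-‿involutive _)) (-‿cong eq))
  signed-injective false false eq = inj₁ (≡.refl , -‿injective eq)

  -- This and `opposite` are the two reasons why a robot is not at the target: it is too close to
  -- the origin, or on the wrong half-line.
  inside : ∀ b c {y z} → - z < y → y < z → ¬ signed b y ≈ signed c z
  inside b c (_ , -z≉y) (_ , y≉z) eq with signed-injective b c eq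
  ... | inj₁ (_ , y≈z) = y≉z y≈z
  ... | inj₂ y≈-z      = -z≉y (sym y≈-z)

  negative : ∀ {z} → 0# < z → - z < 0#
  negative {z} 0<z = <-shift 0<z (begin
    0# - - z  ≈⟨ +-identityˡ (- - z) ⟩
    - - z     ≈⟨ -‿involutive z ⟩
    z         ≈⟨ +-identityʳ z ⟨
    z + 0#    ≈⟨ +-congˡ -0#≈0# ⟨
    z - 0#    ∎)
    where open SetoidReasoning setoid

  positive : ∀ {z} → z < 0# → 0# < - z
  positive {z} z<0 = <-shift z<0 (begin
    - z - 0#  ≈⟨ +-comm (- z) (- 0#) ⟩
    - 0# - z  ≈⟨ +-congʳ -0#≈0# ⟩
    0# - z    ∎)
    where open SetoidReasoning setoid

  opposite : ∀ {b c y z} → b ≢ c → 0# ≤ y → 0# < z → ¬ signed b y ≈ signed c z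
  opposite {b} {c} b≢c 0≤y 0<z eq with signed-injective b c eq
  ... | inj₁ (b≡c , _) = b≢c b≡c
  ... | inj₂ y≈-z      = <⇒≱ (negative 0<z) (≤-respʳ-≈ y≈-z 0≤y)

  -- Speed at most 1 as two linear inequalities without an absolute value, and for all real times,
  -- so that gluing needs no side condition on the sign of time.
  record Feasible (φ : ℝ → ℝ) : Set where
    field
      congruent : ∀ {s t} → s ≈ t → φ s ≈ φ t
      forward   : ∀ {s t} → s ≤ t → φ t - φ s ≤ t - s
      backward  : ∀ {s t} → s ≤ t → φ s - φ t ≤ t - s

  open Feasible

  trajectory : ∀ {φ} → Feasible φ → φ 0# ≈ 0# → Trajectory
  trajectory {φ} feasible start = record
    { at      = φ
    ; at-cong = congruent feasible
    ; start   = start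
    ; speed≤1 = λ {s} {t} _ s≤t → MaxOp.⊔-lub (Max.maxOperator totalOrder) (forward feasible s≤t)
        (≤-respˡ-≈ (reversed (φ s) (φ t)) (backward feasible s≤t))
    }
    where
    reversed : ∀ p q → p - q ≈ - (q - p)
    reversed = solve 2 (λ p q → p :- q := :- (q :- p)) refl

  constant-feasible : ∀ p → Feasible (λ _ → p)
  constant-feasible p = record { congruent = λ _ → refl ; forward = still ; backward = still }
    where
    no-slack : ∀ p s t → t - s - (p - p) ≈ t - s
    no-slack = solve 3 (λ p s t → (t :- s) :- (p :- p) := t :- s) refl
    still : ∀ {s t} → s ≤ t → p - p ≤ t - s
    still {s} {t} s≤t = ≤-shift s≤t (no-slack p s t)

  line : Bool → ℝ → ℝ → ℝ
  line b δ t = signed b (t - δ)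

  line-feasible : ∀ b δ → Feasible (line b δ)
  line-feasible b δ = record
    { congruent = λ s≈t → signed-cong {b} ≡.refl (+-congʳ s≈t)
    ; forward   = forward′ b
    ; backward  = backward′ b
    }
    where
    along : ∀ s t → (t - δ) - (s - δ) ≈ t - s
    along s t = solve 3 (λ s t δ → (t :- δ) :- (s :- δ) := t :- s) refl s t δ
    slack : ∀ s t → (t - s) - ((s - δ) - (t - δ)) ≈ (t + t) - (s + s)
    slack s t = solve 3 (λ s t δ → (t :- s) :- ((s :- δ) :- (t :- δ)) := (t :+ t) :- (s :+ s))
      refl s t δ
    swapped : ∀ x y → x - y ≈ (- y) - (- x)
    swapped = solve 2 (λ x y → x :- y := (:- y) :- (:- x)) refl
    against : ∀ {s t} → s ≤ t → (s - δ) - (t - δ) ≤ t - s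
    against {s} {t} s≤t = ≤-shift (+-mono-≤ s≤t s≤t) (slack s t)
    forward′ : ∀ b {s t} → s ≤ t → line b δ t - line b δ s ≤ t - s
    forward′ true  {s} {t} s≤t = ≤-reflexive (along s t)
    forward′ false {s} {t} s≤t = ≤-respˡ-≈ (swapped (s - δ) (t - δ)) (against s≤t)
    backward′ : ∀ b {s t} → s ≤ t → line b δ s - line b δ t ≤ t - s
    backward′ true  {s} {t} s≤t = against s≤t
    backward′ false {s} {t} s≤t = ≤-respˡ-≈ (swapped (t - δ) (s - δ)) (≤-reflexive (along s t))

  glue : ℝ → (ℝ → ℝ) → (ℝ → ℝ) → ℝ → ℝ
  glue a φ ψ t = if does (em {t ≤ a}) then φ t else ψ t

  glue-≤ : ∀ a φ ψ {t} → t ≤ a → glue a φ ψ t ≈ φ t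
  glue-≤ a φ ψ {t} t≤a with em {t ≤ a}
  ... | yes _  = refl
  ... | no t≰a = contradiction t≤a t≰a

  module _ {a φ ψ} (smooth : Feasible φ) (smooth′ : Feasible ψ) (joined : φ a ≈ ψ a) where

    glue-≥ : ∀ {t} → a ≤ t → glue a φ ψ t ≈ ψ t
    glue-≥ {t} a≤t with em {t ≤ a}
    ... | no _    = refl
    ... | yes t≤a = trans (congruent smooth t≈a) (trans joined (congruent smooth′ (sym t≈a)))
      where
      t≈a : t ≈ a
      t≈a = antisym t≤a a≤t

    -- Between times on different sides of a, the displacement is split at a, where the two pieces
    -- meet.
    glue-feasible : Feasible (glue a φ ψ)
    glue-feasible = record { congruent = glued ; forward = forward′ ; backward = backward′ }
      where
      γ : ℝ → ℝ
      γ = glue a φ ψ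

      before : ∀ {t} → t ≤ a → γ t ≈ φ t
      before = glue-≤ a φ ψ

      glued : ∀ {s t} → s ≈ t → γ s ≈ γ t
      glued {s} {t} s≈t with total t a
      ... | inj₁ t≤a = trans (before (≤-respˡ-≈ (sym s≈t) t≤a)) (trans (congruent smooth s≈t)
            (sym (before t≤a)))
      ... | inj₂ a≤t = trans (glue-≥ (≤-respʳ-≈ (sym s≈t) a≤t)) (trans (congruent smooth′ s≈t)
            (sym (glue-≥ a≤t)))

      transport : ∀ {x x′ y y′ z} → x ≈ x′ → y ≈ y′ → x′ - y′ ≤ z → x - y ≤ z
      transport x≈ y≈ = ≤-respˡ-≈ (sym (+-cong x≈ (-‿cong y≈)))

      telescope : ∀ x y z → (x - y) + (y - z) ≈ x - z
      telescope = solve 3 (λ x y z → (x :- y) :+ (y :- z) := x :- z) refl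

      chain : ∀ {x y y′ z u v} → y ≈ y′ → x - y ≤ u → y′ - z ≤ v → x - z ≤ u + v
      chain {x} {y} {y′} {z} y≈y′ x-y≤u y′-z≤v =
        ≤-respˡ-≈ (telescope x y′ z) (+-mono-≤ (≤-respˡ-≈ (+-congˡ (-‿cong y≈y′)) x-y≤u) y′-z≤v)

      forward′ : ∀ {s t} → s ≤ t → γ t - γ s ≤ t - s
      forward′ {s} {t} s≤t with total t a | total a s
      ... | inj₁ t≤a | _        = transport (before t≤a) (before (≤-trans s≤t t≤a))
            (forward smooth s≤t)
      ... | inj₂ a≤t | inj₂ s≤a = transport (glue-≥ a≤t) (before s≤a)
        (≤-respʳ-≈ (telescope t a s) (chain (sym joined) (forward smooth′ a≤t)
          (forward smooth s≤a)))
      ... | inj₂ a≤t | inj₁ a≤s = transport (glue-≥ a≤t) (glue-≥ a≤s) (forward smooth′ s≤t)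

      backward′ : ∀ {s t} → s ≤ t → γ s - γ t ≤ t - s
      backward′ {s} {t} s≤t with total t a | total a s
      ... | inj₁ t≤a | _        = transport (before (≤-trans s≤t t≤a)) (before t≤a)
            (backward smooth s≤t)
      ... | inj₂ a≤t | inj₂ s≤a = transport (before s≤a) (glue-≥ a≤t)
        (≤-respʳ-≈ (trans (+-comm (a - s) (t - a)) (telescope t a s))
          (chain joined (backward smooth s≤a) (backward smooth′ a≤t)))
      ... | inj₂ a≤t | inj₁ a≤s = transport (glue-≥ a≤s) (glue-≥ a≤t) (backward smooth′ s≤t)

-- The number of announcements that starts a detour when r detours are left.

level : ℕ → ℕ → ℕ
level zero    w = w
level (suc r) w = level r w ℕ.+ level r w

-- A lower bound for the number of faults exposed by r detours, plus the margin
-- of the final vote.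

gain : ℕ → ℕ → ℕ
gain zero    w = w
gain (suc r) w = level (suc r) w ℕ.+ gain r (w ℕ.+ w ℕ.+ w)

-- The strategy as a function of the messages, and its causality.

module Strategy (em : ExcludedMiddle 0ℓ) (R : CompleteOrderedField) (n f : ℕ) where

  open CompleteOrderedField R hiding (zero)
  open OrderedField R
  open LineSearch R
  open Motion em R
  open Feasible
  open Classical em

  -- During a detour a crossing robot already follows its later outward line, while
  -- the others wait at distance x.

  leg : Bool → Bool → ℝ → ℝ → ℝ → ℝ
  leg b b′ x δ = if does (b ≟ b′) then (λ _ → signed b x) else line b′ δ

  -- The points up to distance reach have been searched, and at time t the robots
  -- are at distance t - delay.

  record State : Set where
    no-eta-equality
    field
      right    : Subset n
      suspects : Subset n
      reach    : ℝ
      delay    : ℝ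

    side : Fin n → Bool
    side = lookup right

    arrival : ℝ → ℝ
    arrival x = x + delay

  open State public

  Speaks : History n → ℝ → Fin n → Set
  Speaks H t i = ∃[ z ] Sent H i z t

  SpeaksBetween : History n → ℝ → ℝ → Fin n → Set
  SpeaksBetween H a b i = ∃[ t ] (a < t × t < b × Speaks H t i)

  -- Crossing between the two points at distance x takes time 2x; the delay grows by it for the
  -- waiting robots too, so both sides resume together.
  after-conflict : State → ℕ → ℝ → Subset n → Subset n → State
  after-conflict S h x D K = record
    { right    = Crossing.regrouped f h (right S) D K
    ; suspects = D ∪ K
    ; reach    = x
    ; delay    = delay S + (x + x)
    }

  module _ (S : State) (H : History n) where

    -- If the target is at distance at least x, whoever speaks after the search resumes and before x
    -- is reached is lying. Announcements made strictly after a conflict, up to and including the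
    -- end of its detour, accuse nobody.
    accused : ℝ → Subset n
    accused x = ⟦ (λ i → i ∈ suspects S ⊎ SpeaksBetween H (arrival S (reach S)) (arrival S x) i) ⟧

    -- The announced location does not matter, since a reliable robot speaks only at
    -- the target.

    claimants : ℝ → Subset n
    claimants x = ⟦ (λ i → i ∉ accused x × Speaks H (arrival S x) i) ⟧

    Conflict : ℕ → ℝ → Set
    Conflict e x = 0# ≤ x × reach S < x × e ℕ.≤ # claimants x

    -- An attained minimum, not an infimum: in an execution, `minimal-conflict` provides it as soon
    -- as there is a conflict with positive e.
    FirstConflict : ℕ → ℝ → Set
    FirstConflict e x = Conflict e x × (∀ y → y < x → ¬ Conflict e y)

    next : ℕ → ℝ → State
    next h x = after-conflict S h x (accused x) (claimants x)

  ≤-add-double : ∀ {x δ} → 0# ≤ x → δ ≤ δ + (x + x)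
  ≤-add-double {x} {δ} 0≤x = ≤-respˡ-≈ (trans (+-congˡ (+-identityʳ 0#)) (+-identityʳ δ))
    (+-monoʳ-≤ δ (+-mono-≤ 0≤x 0≤x))

  line-at : ∀ b x δ → line b δ (x + δ) ≈ signed b x
  line-at b x δ = signed-cong {b} ≡.refl (cancel x δ)
    where
    cancel : ∀ x δ → x + δ - δ ≈ x
    cancel = solve 2 (λ x δ → x :+ δ :- δ := x) refl

  leg-feasible : ∀ b b′ x δ → Feasible (leg b b′ x δ)
  leg-feasible b b′ x δ with b ≟ b′
  ... | yes _ = constant-feasible (signed b x)
  ... | no  _ = line-feasible b′ δ

  leg-start : ∀ b b′ x δ → leg b b′ x (δ + (x + x)) (x + δ) ≈ signed b x
  leg-start b b′ x δ with b ≟ b′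
  ... | yes _   = refl
  ... | no b≢b′ = trans (signed-cong (¬-not (b≢b′ ∘ ≡.sym)) (mirror x δ)) (signed-not b x)
    where
    mirror : ∀ x δ → x + δ - (δ + (x + x)) ≈ - x
    mirror = solve 2 (λ x δ → x :+ δ :- (δ :+ (x :+ x)) := :- x) refl

  leg-end : ∀ b b′ x δ → leg b b′ x δ (x + δ) ≈ signed b′ x
  leg-end b b′ x δ with b ≟ b′
  ... | yes b≡b′ = signed-cong b≡b′ refl
  ... | no _     = line-at b′ x δ

  leg-cases : ∀ b b′ x δ t → leg b b′ x δ t ≈ signed b x ⊎ leg b b′ x δ t ≈ signed b′ (t - δ)
  leg-cases b b′ x δ t with b ≟ b′
  ... | yes _ = inj₁ refl
  ... | no  _ = inj₂ refl

  leg-turned : ∀ {b b′} x δ t → b ≢ b′ → leg b b′ x δ t ≈ signed b′ (t - δ)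
  leg-turned {b} {b′} x δ t b≢b′ with b ≟ b′
  ... | yes b≡b′ = contradiction b≡b′ b≢b′
  ... | no  _    = refl

  outward : State → Fin n → ℝ → ℝ
  outward S i = line (side S i) (delay S)

  -- The recursion is on the number of detours left. `resume` takes the decision about a first
  -- conflict as an argument, so that its properties can be proved by cases on it. With h =
  -- `level r w`, passing from `suc r` and w to r and 3w turns the margin 2h into 3h.
  path   : ℕ → ℕ → State → History n → Fin n → ℝ → ℝ
  resume : ∀ r w S H → Dec (∃ (FirstConflict S H (level (suc r) w))) → Fin n → ℝ → ℝ
  after  : ℕ → ℕ → State → History n → ℝ → Fin n → ℝ → ℝ

  path zero    w S H i = outward S i
  path (suc r) w S H i = resume r w S H em i

  resume r w S H (no _)        i = outward S i
  resume r w S H (yes (x , _)) i = glue (arrival S x) (outward S i) (after r w S H x i)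

  after r w S H x i =
    glue (arrival S′ x) (leg (side S i) (side S′ i) x (delay S′)) (path r (w ℕ.+ w ℕ.+ w) S′ H i)
    where
    S′ = next S H (level r w) x

  resume-start : ∀ r w S H d i →
                 resume r w S H d i (arrival S (reach S)) ≈ signed (side S i) (reach S)
  resume-start r w S H (no _)                        i = line-at (side S i) (reach S) (delay S)
  resume-start r w S H (yes (x , (_ , s<x , _) , _)) i = trans
    (glue-≤ (arrival S x) (outward S i) (after r w S H x i) (+-mono-≤ (<⇒≤ s<x) ≤-refl))
    (line-at (side S i) (reach S) (delay S))

  path-start : ∀ r w S H i → path r w S H i (arrival S (reach S)) ≈ signed (side S i) (reach S)
  path-start zero    w S H i = line-at (side S i) (reach S) (delay S)
  path-start (suc r) w S H i = resume-start r w S H em i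

  after-≤ : ∀ r w S H x i {t} → let S′ = next S H (level r w) x in
            t ≤ arrival S′ x → after r w S H x i t ≈ leg (side S i) (side S′ i) x (delay S′) t
  after-≤ r w S H x i = glue-≤ (arrival S′ x) (leg (side S i) (side S′ i) x (delay S′))
    (path r (w ℕ.+ w ℕ.+ w) S′ H i)
    where
    S′ = next S H (level r w) x

  outward-meets-after : ∀ r w S H x i → 0# ≤ x →
                        outward S i (arrival S x) ≈ after r w S H x i (arrival S x)
  outward-meets-after r w S H x i 0≤x = trans (line-at (side S i) x (delay S)) (sym (trans
    (after-≤ r w S H x i (+-monoʳ-≤ x (≤-add-double 0≤x)))
    (leg-start (side S i) (side (next S H (level r w) x) i) x (delay S))))

  leg-meets-path : ∀ r w S H x i → let S′ = next S H (level r w) x in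
         leg (side S i) (side S′ i) x (delay S′) (arrival S′ x) ≈ path r (w ℕ.+ w ℕ.+ w) S′ H i
           (arrival S′ x)
  leg-meets-path r w S H x i = trans (leg-end (side S i) (side S′ i) x (delay S′))
    (sym (path-start r (w ℕ.+ w ℕ.+ w) S′ H i))
    where
    S′ = next S H (level r w) x

  path-feasible   : ∀ r w S H i → Feasible (path r w S H i)
  resume-feasible : ∀ r w S H d i → Feasible (resume r w S H d i)
  after-feasible  : ∀ r w S H x i → Feasible (after r w S H x i)

  path-feasible zero    w S H i = line-feasible (side S i) (delay S)
  path-feasible (suc r) w S H i = resume-feasible r w S H em i

  resume-feasible r w S H (no _)                    i = line-feasible (side S i) (delay S)
  resume-feasible r w S H (yes (x , (0≤x , _) , _)) i =
    glue-feasible (line-feasible (side S i) (delay S)) (after-feasible r w S H x i)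
      (outward-meets-after r w S H x i 0≤x)

  after-feasible r w S H x i =
    glue-feasible (leg-feasible (side S i) (side S′ i) x (delay S′))
      (path-feasible r (w ℕ.+ w ℕ.+ w) S′ H i) (leg-meets-path r w S H x i)
    where
    S′ = next S H (level r w) x

  after-≥ : ∀ r w S H x i {t} → let S′ = next S H (level r w) x in
            arrival S′ x ≤ t → after r w S H x i t ≈ path r (w ℕ.+ w ℕ.+ w) S′ H i t
  after-≥ r w S H x i =
    glue-≥ (leg-feasible (side S i) (side S′ i) x (delay S′)) (path-feasible r (w ℕ.+ w ℕ.+ w) S′
      H i) (leg-meets-path r w S H x i)
    where
    S′ = next S H (level r w) x

  first-≤ : ∀ S H {e x y} → FirstConflict S H e x → Conflict S H e y → x ≤ y
  first-≤ S H {x = x} {y} (_ , first) conflict with em {x ≤ y}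
  ... | yes x≤y = x≤y
  ... | no  x≰y = contradiction conflict (first y (≰⇒> x≰y))

  first-unique : ∀ S H {e x y} → FirstConflict S H e x → FirstConflict S H e y → x ≈ y
  first-unique S H fx fy = antisym (first-≤ S H fx (proj₁ fy)) (first-≤ S H fy (proj₁ fx))

  Agree : ℝ → History n → History n → Set
  Agree T = AgreeOn (_≤ T)

  agree-sym : ∀ {T H H′} → Agree T H H′ → Agree T H′ H
  agree-sym agree i z t t≤T = mk⇔ (Equivalence.from (agree i z t t≤T))
    (Equivalence.to (agree i z t t≤T))

  agree-mono : ∀ {T T′ H H′} → T′ ≤ T → Agree T H H′ → Agree T′ H H′
  agree-mono T′≤T agree i z t t≤T′ = agree i z t (≤-trans t≤T′ T′≤T)

  agree-refl : ∀ {T} H → Agree T H H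
  agree-refl H i z t _ = mk⇔ id id

  -- Excluded middle may select different representatives of the same conflict distance, so the real
  -- components agree only up to `≈`.
  record _≋_ (S S′ : State) : Set where
    field
      right≡    : right S ≡ right S′
      suspects≡ : suspects S ≡ suspects S′
      reach≈    : reach S ≈ reach S′
      delay≈    : delay S ≈ delay S′

    side≡ : ∀ i → side S i ≡ side S′ i
    side≡ i = ≡.cong (λ P → lookup P i) right≡

    arrival≈ : ∀ {x x′} → x ≈ x′ → arrival S x ≈ arrival S′ x′
    arrival≈ x≈x′ = +-cong x≈x′ delay≈

  open _≋_

  ≋-refl : ∀ {S} → S ≋ S
  ≋-refl = record { right≡ = ≡.refl ; suspects≡ = ≡.refl ; reach≈ = refl ; delay≈ = refl }

  ≋-sym : ∀ {S S′} → S ≋ S′ → S′ ≋ S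
  ≋-sym S≋S′ = record
    { right≡    = ≡.sym (right≡ S≋S′)
    ; suspects≡ = ≡.sym (suspects≡ S≋S′)
    ; reach≈    = sym (reach≈ S≋S′)
    ; delay≈    = sym (delay≈ S≋S′)
    }

  module _ {S S′ : State} {H H′ : History n} (S≋S′ : S ≋ S′) where

    private
      speaks-resp : ∀ {K K′ : History n} {T t t′ i} → Agree T K K′ → t ≤ T → t ≈ t′ → Speaks K t
        i → Speaks K′ t′ i
      speaks-resp {K′ = K′} agree t≤T t≈t′ (z , sent) =
        z , Sent-resp K′ refl t≈t′ (Equivalence.to (agree _ z _ t≤T) sent)

      between-resp : ∀ {K K′ : History n} {a a′ b b′ i} → Agree b K K′ → a ≈ a′ → b ≈ b′ →
                     SpeaksBetween K a b i → SpeaksBetween K′ a′ b′ i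
      between-resp {K} {K′} agree a≈a′ b≈b′ (t , a<t , t<b , speaks) =
        t , <-respˡ-≈ a≈a′ a<t , <-respʳ-≈ b≈b′ t<b , speaks-resp {K} {K′} agree (<⇒≤ t<b) refl
          speaks

    accused-resp : ∀ {x x′} → x ≈ x′ → Agree (arrival S x) H H′ → accused S H x ≡ accused S′ H′ x′
    accused-resp {x} {x′} x≈x′ agree = ⟦⟧-cong λ i → mk⇔
      (Sum.map (≡.subst (i ∈_) (suspects≡ S≋S′))
               (between-resp {H} {H′} agree (arrival≈ S≋S′ (reach≈ S≋S′)) (arrival≈ S≋S′ x≈x′)))
      (Sum.map (≡.subst (i ∈_) (≡.sym (suspects≡ S≋S′)))
               (between-resp {H′} {H} (agree-mono {H = H′} {H}
                 (≤-reflexive (sym (arrival≈ S≋S′ x≈x′))) (agree-sym {H = H} {H′} agree))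
                 (sym (arrival≈ S≋S′ (reach≈ S≋S′))) (sym (arrival≈ S≋S′ x≈x′))))

    claimants-resp : ∀ {x x′} → x ≈ x′ → Agree (arrival S x) H H′ → claimants S H x ≡ claimants S′
      H′ x′
    claimants-resp {x} {x′} x≈x′ agree = ⟦⟧-cong λ i → mk⇔
      (λ (i∉ , speaks) → (i∉ ∘ ≡.subst (i ∈_) (≡.sym (accused-resp x≈x′ agree)))
                       , speaks-resp {H} {H′} agree ≤-refl (arrival≈ S≋S′ x≈x′) speaks)
      (λ (i∉ , speaks) → (i∉ ∘ ≡.subst (i ∈_) (accused-resp x≈x′ agree))
                       , speaks-resp {H′} {H} (agree-sym {H = H} {H′} agree)
                             (≤-reflexive (sym (arrival≈ S≋S′ x≈x′)))
                           (sym (arrival≈ S≋S′ x≈x′)) speaks)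

    next-resp : ∀ h {x x′} → x ≈ x′ → Agree (arrival S x) H H′ → next S H h x ≋ next S′ H′ h x′
    next-resp h x≈x′ agree = record
      { right≡    = ≡.trans (≡.cong₂ (λ D K → Crossing.regrouped f h (right S) D K)
            (accused-resp x≈x′ agree) (claimants-resp x≈x′ agree))
                            (≡.cong (λ P → Crossing.regrouped f h P _ _) (right≡ S≋S′))
      ; suspects≡ = ≡.cong₂ _∪_ (accused-resp x≈x′ agree) (claimants-resp x≈x′ agree)
      ; reach≈    = x≈x′
      ; delay≈    = +-cong (delay≈ S≋S′) (+-cong x≈x′ x≈x′)
      }

    conflict-resp : ∀ {e x x′} → x ≈ x′ → Agree (arrival S x) H H′ → Conflict S H e x → Conflict
      S′ H′ e x′
    conflict-resp {e} x≈x′ agree (0≤x , s<x , e≤) =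
      ≤-respʳ-≈ x≈x′ 0≤x , <-respˡ-≈ (reach≈ S≋S′) (<-respʳ-≈ x≈x′ s<x) ,
      ≡.subst (λ K → e ℕ.≤ # K) (claimants-resp x≈x′ agree) e≤

  -- Whether there is a conflict at a distance depends only on messages up to the arrival there. An
  -- earlier conflict in one history would thus be one in the other too.
  first-resp : ∀ {S S′ H H′ e x x′} → S ≋ S′ → x ≈ x′ → Agree (arrival S x) H H′ →
               FirstConflict S H e x → FirstConflict S′ H′ e x′
  first-resp {S} {S′} {H} {H′} S≋S′ x≈x′ agree (conflict , first) =
    conflict-resp {H = H} {H′} S≋S′ x≈x′ agree conflict ,
    λ y y<x′ → first y (<-respʳ-≈ (sym x≈x′) y<x′) ∘ conflict-resp {H = H′} {H} (≋-sym S≋S′) refl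
      (agree-mono {H = H′} {H} (≤-trans (+-mono-≤ (<⇒≤ y<x′) ≤-refl)
        (≤-reflexive (sym (arrival≈ S≋S′ x≈x′)))) (agree-sym {H = H} {H′} agree))

  leg-resp : ∀ {b b′ c c′ x x′ δ δ′ t} → b ≡ c → b′ ≡ c′ → x ≈ x′ → δ ≈ δ′ →
             leg b b′ x δ t ≈ leg c c′ x′ δ′ t
  leg-resp {b} {b′} ≡.refl ≡.refl x≈x′ δ≈δ′ with b ≟ b′
  ... | yes _ = signed-cong {b} ≡.refl x≈x′
  ... | no  _ = signed-cong {b′} ≡.refl (+-congˡ (-‿cong δ≈δ′))

  outward-resp : ∀ {S S′ i t} → S ≋ S′ → outward S i t ≈ outward S′ i t
  outward-resp {i = i} S≋S′ = signed-cong (≡.cong (λ P → lookup P i) (right≡ S≋S′))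
    (+-congˡ (-‿cong (delay≈ S≋S′)))

  resume-before : ∀ r w S H d i {t} → (∀ x → FirstConflict S H (level (suc r) w) x → t ≤ arrival S
    x) →
                  resume r w S H d i t ≈ outward S i t
  resume-before r w S H (no _)        i early = refl
  resume-before r w S H (yes (x , first)) i early =
    glue-≤ (arrival S x) (outward S i) (after r w S H x i) (early x first)

  -- The decision d carries its own witness y, only known to be `≈ x`. Exchanging the two needs
  -- `after-resp`, whence the mutual recursion.
  resume-after : ∀ r w S H d i {x t} → FirstConflict S H (level (suc r) w) x → arrival S x ≤ t →
                 resume r w S H d i t ≈ after r w S H x i t
  -- This yields causality. A first conflict reached strictly before t is settled by the messages
  -- before t; one reached at t or later does not affect the position at t.
  path-resp    : ∀ r w {S S′ H H′ t} i → S ≋ S′ → AgreeOn (_< t) H H′ →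
                 path r w S H i t ≈ path r w S′ H′ i t
  after-resp   : ∀ r w {S S′ H H′ x x′ t} i → S ≋ S′ → x ≈ x′ → Agree (arrival S x) H H′ → AgreeOn
    (_< t) H H′ →
                 after r w S H x i t ≈ after r w S′ H′ x′ i t

  resume-after r w S H (no none) i first _ = contradiction (_ , first) none
  resume-after r w S H (yes (y , fy@((0≤y , _) , _))) i {x} {t} first x≤t = trans
    (glue-≥ (line-feasible (side S i) (delay S)) (after-feasible r w S H y i)
      (outward-meets-after r w S H y i 0≤y)
      (≤-respˡ-≈ (+-congʳ x≈y) x≤t))
    (after-resp r w {S} {S} {H} {H} i ≋-refl (sym x≈y) (agree-refl H) (λ i z s _ → mk⇔ id id))
    where
    x≈y : x ≈ y
    x≈y = first-unique S H first fy

  path-resp zero    w i S≋S′ agree = outward-resp S≋S′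
  path-resp (suc r) w {S} {S′} {H} {H′} {t} i S≋S′ agree
    with em {∃[ x ] (FirstConflict S H (level (suc r) w) x × arrival S x < t)}
  ... | yes (x , first , x<t) = trans (resume-after r w S H em i first (<⇒≤ x<t)) (trans
    (after-resp r w i S≋S′ refl agree-x agree)
    (sym (resume-after r w S′ H′ em i (first-resp {H = H} {H′} S≋S′ refl agree-x first)
      (≤-respˡ-≈ (arrival≈ S≋S′ refl) (<⇒≤ x<t)))))
    where
    agree-x : Agree (arrival S x) H H′
    agree-x i z s s≤ = agree i z s (≤-<-trans s≤ x<t)
  ... | no none = trans (resume-before r w S H em i early) (trans
    (outward-resp S≋S′)
    (sym (resume-before r w S′ H′ em i early′)))
    where
    early : ∀ x → FirstConflict S H (level (suc r) w) x → t ≤ arrival S x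
    early x first with em {t ≤ arrival S x}
    ... | yes t≤ = t≤
    ... | no  t≰ = contradiction (x , first , ≰⇒> t≰) none
    early′ : ∀ x → FirstConflict S′ H′ (level (suc r) w) x → t ≤ arrival S′ x
    early′ x first with em {t ≤ arrival S′ x}
    ... | yes t≤ = t≤
    ... | no  t≰ = contradiction
      (x , first-resp {H = H′} {H} (≋-sym S≋S′) refl (λ i z s s≤ → let eqv = agree i z s
                                                                         (≤-<-trans s≤ (≰⇒> t≰))
                                                                         in mk⇔ (Equivalence.from
                                                                         eqv) (Equivalence.to
                                                                         eqv)) first
         , <-respˡ-≈ (arrival≈ (≋-sym S≋S′) refl) (≰⇒> t≰)) none

  after-resp r w {S} {S′} {H} {H′} {x} {x′} {t} i S≋S′ x≈x′ agree-x agree = split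
    (total t (arrival N x))
    where
    w₃ = w ℕ.+ w ℕ.+ w
    N  = next S H (level r w) x
    N′ = next S′ H′ (level r w) x′
    N≋N′ : N ≋ N′
    N≋N′ = next-resp {H = H} {H′} S≋S′ (level r w) x≈x′ agree-x
    split : t ≤ arrival N x ⊎ arrival N x ≤ t → after r w S H x i t ≈ after r w S′ H′ x′ i t
    split (inj₁ t≤) = trans (after-≤ r w S H x i t≤) (trans
      (leg-resp (side≡ S≋S′ i) (side≡ N≋N′ i) x≈x′ (delay≈ N≋N′))
      (sym (after-≤ r w S′ H′ x′ i (≤-respʳ-≈ (arrival≈ N≋N′ x≈x′) t≤))))
    split (inj₂ ≤t) = trans (after-≥ r w S H x i ≤t) (trans
      (path-resp r w₃ i N≋N′ agree)
      (sym (after-≥ r w S′ H′ x′ i (≤-respˡ-≈ (arrival≈ N≋N′ x≈x′) ≤t))))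

level-positive : ∀ r {w} → 1 ℕ.≤ w → 1 ℕ.≤ level r w
level-positive zero    1≤w = 1≤w
level-positive (suc r) 1≤w = ℕ.≤-trans (level-positive r 1≤w) (ℕ.m≤m+n _ _)

-- Since `level (suc r) w` is twice `level r w`, tripling w and using up one detour multiplies the
-- margin by 3/2.
level-triple : ∀ r w → level r (w ℕ.+ w ℕ.+ w) ≡ level r w ℕ.+ level r w ℕ.+ level r w
level-triple zero    w = ≡.refl
level-triple (suc r) w = ≡.trans (≡.cong₂ ℕ._+_ (level-triple r w) (level-triple r w))
  (solve′ 1 (λ x → (x ⊕ x ⊕ x) ⊕ (x ⊕ x ⊕ x) ⊜ (x ⊕ x) ⊕ (x ⊕ x) ⊕ (x ⊕ x)) ≡.refl (level r w))
  where open +-*-Solver renaming (solve to solve′; _:+_ to _⊕_; _:=_ to _⊜_)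

-- The invariant of a round and its preservation in an execution.

module Analysis (em : ExcludedMiddle 0ℓ) (R : CompleteOrderedField) (n f : ℕ) where

  open CompleteOrderedField R hiding (zero)
  open OrderedField R
  open LineSearch R
  open Motion em R
  open Classical em
  open Strategy em R n f

  heard : ∀ {A : Algorithm n} → Scenario A f → ℝ → Subset n
  heard E T = ⟦ (λ i → Reliable E i × ∃[ t ] (t ≤ T × Announces E i t)) ⟧

  at-target : ∀ {A : Algorithm n} (E : Scenario A f) {i t} → Reliable E i → Announces E i t → at
    (motion E i) t ≈ target E
  at-target E reliable announces = proj₁ (proj₂ (Equivalence.to (reliable-report E reliable _)
    announces))

  -- Otherwise all the reliable robots of E that were heard would be faulty in E′, together with D,
  -- which is disjoint from them: more than f faults.
  common-witness : ∀ {A : Algorithm n} (E E′ : Scenario A f) T {D} →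
    (∀ {i} → i ∈ D → i ∈ faulty E) → (∀ {i} → i ∈ D → i ∈ faulty E′) → f ℕ.< # heard E T ℕ.+ # D →
    ∃[ i ] (Reliable E i × Reliable E′ i × ∃[ t ] (t ≤ T × Announces E i t))
  common-witness E E′ T {D} sound sound′ enough with em {∃[ i ] (i ∈ heard E T × Reliable E′ i)}
  ... | yes (i , i∈ , reliable′) = let reliable , rest = ⟦⟧⁻ _ i∈ in i , reliable , reliable′ ,
                                         rest
  ... | no none = contradiction
    (ℕ.≤-trans (#-disjoint (heard E T) D (faulty E′) (λ i∈ → proj₁ (⟦⟧⁻ _ i∈) ∘ sound)
      [ all-faulty , sound′ ]′) (#faulty≤f E′))
    (ℕ.<⇒≱ enough)
    where
    all-faulty : ∀ {i} → i ∈ heard E T → i ∈ faulty E′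
    all-faulty {i} i∈ with em {i ∈ faulty E′}
    ... | yes y = y
    ... | no  y = contradiction (i , i∈ , y) none

  -- A common witness announces in both executions, and a message carries the true location of its
  -- sender, which is the target in both.
  same-target : ∀ {A : Algorithm n} (E E′ : Scenario A f) T {D} →
    (∀ {i} → i ∈ D → i ∈ faulty E) → (∀ {i} → i ∈ D → i ∈ faulty E′) → f ℕ.< # heard E T ℕ.+ # D →
    Agree T (history E) (history E′) → target E ≈ target E′
  same-target E E′ T sound sound′ enough agree with common-witness E E′ T sound sound′ enough
  ... | i , reliable , reliable′ , t , t≤T , announces
    with Equivalence.to (agree i (at (motion E i) t) t t≤T) (announces , refl)
  ... | announces′ , here≈ = trans (sym (at-target E reliable announces))
        (trans here≈ (at-target E′ reliable′ announces′))

  -- The invariant at the start of a round with r detours left, the target being at distance ρ on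
  -- side b. By `sides`, each side exceeds the remaining faults by `level r w`. By `profit`, the
  -- faults exposed so far, those yet to be exposed and the final margin together exceed f.
  record InRound {A : Algorithm n} (E : Scenario A f) (b : Bool) (ρ : ℝ) (r w : ℕ) (S : State) :
    Set where
    field
      0≤reach : 0# ≤ reach S
      0≤delay : 0# ≤ delay S
      ahead   : reach S < ρ
      follows : ∀ {i t} → Reliable E i → arrival S (reach S) ≤ t →
                at (motion E i) t ≈ path r w S (history E) i t
      unseen  : ∀ {i t} → Reliable E i → 0# ≤ t → t ≤ arrival S (reach S) → ¬ at (motion E i) t
        ≈ signed b ρ
      sound   : ∀ {i} → i ∈ suspects S → i ∈ faulty E
      sides   : ∀ c → f ℕ.+ level r w ℕ.≤ # free (right S) (suspects S) c ℕ.+ # suspects S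
      profit  : f ℕ.< gain r w ℕ.+ # suspects S
      1≤w     : 1 ℕ.≤ w

  minus-≤ : ∀ {x t δ} → t ≤ x + δ → t - δ ≤ x
  minus-≤ {x} {t} {δ} t≤ = ≤-shift t≤ (solve 3 (λ x t δ → x :- (t :- δ) := (x :+ δ) :- t) refl x t
    δ)

  minus-< : ∀ {x t δ} → t < x + δ → t - δ < x
  minus-< {x} {t} {δ} t< = <-shift t< (solve 3 (λ x t δ → x :- (t :- δ) := (x :+ δ) :- t) refl x t
    δ)

  ≤-minus : ∀ {x t δ} → x + δ ≤ t → x ≤ t - δ
  ≤-minus {x} {t} {δ} ≤t = ≤-shift ≤t (solve 3 (λ x t δ → (t :- δ) :- x := t :- (x :+ δ)) refl x t
    δ)

  module InScenario {A : Algorithm n} (E : Scenario A f) (b : Bool) (ρ : ℝ) (0<ρ : 0# < ρ)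
    (target≈ : target E ≈ signed b ρ) where

    H : History n
    H = history E

    unreliable : ∀ {i} → ¬ Reliable E i → i ∈ faulty E
    unreliable {i} ¬reliable with em {i ∈ faulty E}
    ... | yes i∈ = i∈
    ... | no  i∉ = contradiction i∉ ¬reliable

    -- D uses up part of the f faults, so at most f - `# D` members of Q are faulty and all the
    -- others are in V.
    count-reliable : ∀ {Q D V : Subset n} → (∀ {i} → i ∈ D → i ∈ faulty E) →
      (∀ {i} → i ∈ Q → i ∉ D) →
                     (∀ {i} → i ∈ Q → Reliable E i → i ∈ V) → # Q ℕ.+ # D ℕ.≤ # V ℕ.+ f
    count-reliable {Q} {D} {V} sound disjoint counted = ℕ.≤-trans
      (#-cover Q D V (faulty E) disjoint [ split , inj₂ ∘ sound ]′)
      (ℕ.+-monoʳ-≤ (# V) (#faulty≤f E))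
      where
      split : ∀ {i} → i ∈ Q → i ∈ V ⊎ i ∈ faulty E
      split {i} i∈ with em {i ∈ faulty E}
      ... | yes i∈F = inj₂ i∈F
      ... | no  i∉F = inj₁ (counted i∈ i∉F)

    announces-at : ∀ {i t} → Reliable E i → Announces E i t → at (motion E i) t ≈ signed b ρ
    announces-at reliable announces = trans (at-target E reliable announces) target≈

    arrives : ∀ {i t} → Reliable E i → 0# ≤ t → at (motion E i) t ≈ signed b ρ →
              (∀ s → 0# ≤ s → s < t → ¬ at (motion E i) s ≈ signed b ρ) → Announces E i t
    arrives reliable 0≤t found before = Equivalence.from (reliable-report E reliable _)
      (0≤t , trans found (sym target≈) , λ s 0≤s s<t eq → before s 0≤s s<t (trans eq target≈))

    -- The outward phase up to a distance y not beyond the target. It is used with y = ρ and with y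
    -- the first conflict.
    module Straight {r w S} (round : InRound E b ρ r w S) {y : ℝ} (s≤y : reach S ≤ y)
      (y≤ρ : y ≤ ρ)
      (straight : ∀ {i t} → Reliable E i → arrival S (reach S) ≤ t → t ≤ arrival S y →
                  at (motion E i) t ≈ signed (side S i) (t - delay S)) where

      open InRound round

      0≤y : 0# ≤ y
      0≤y = ≤-trans 0≤reach s≤y

      0≤arrival : 0# ≤ arrival S y
      0≤arrival = ≤-respˡ-≈ (+-identityʳ 0#) (+-mono-≤ 0≤y 0≤delay)

      -ρ<_ : ∀ {z} → 0# ≤ z → - ρ < z
      -ρ< 0≤z = <-≤-trans (negative 0<ρ) 0≤z

      unseen-straight : ∀ {i t} → Reliable E i → 0# ≤ t → t ≤ arrival S y → t - delay S < ρ ⊎ side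
        S i ≢ b →
                        ¬ at (motion E i) t ≈ signed b ρ
      unseen-straight {i} {t} reliable 0≤t t≤ away eq with total t (arrival S (reach S))
      ... | inj₁ t≤s = unseen reliable 0≤t t≤s eq
      ... | inj₂ s≤t = [ (λ z<ρ → inside (side S i) b (-ρ< 0≤z) z<ρ eq′) ,
            (λ σ≢b → opposite σ≢b 0≤z 0<ρ eq′) ]′ away
        where
        eq′ : signed (side S i) (t - delay S) ≈ signed b ρ
        eq′ = trans (sym (straight reliable s≤t t≤)) eq
        0≤z : 0# ≤ t - delay S
        0≤z = ≤-trans 0≤reach (≤-minus s≤t)

      -- A reliable robot speaks only at the target, and before distance y ≤ ρ is reached it cannot
      -- be there.
      accused-sound : ∀ {i} → i ∈ accused S H y → i ∈ faulty E
      accused-sound {i} i∈ with ⟦⟧⁻ _ i∈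
      ... | inj₁ i∈D = sound i∈D
      ... | inj₂ (t , s<t , t<y , z , announces , _) = unreliable λ reliable →
        unseen-straight reliable (announce-time E announces) (<⇒≤ t<y)
          (inj₁ (<-≤-trans (minus-< t<y) y≤ρ)) (announces-at reliable announces)

      #accused≤f : # accused S H y ℕ.≤ f
      #accused≤f = ℕ.≤-trans (p⊆q⇒∣p∣≤∣q∣ accused-sound) (#faulty≤f E)

      sides-now : ∀ c → f ℕ.+ level r w ℕ.≤ # free (right S) (accused S H y) c ℕ.+ # accused S H y
      sides-now c = ℕ.≤-trans (sides c) (free-∪ (right S) (suspects S) (accused S H y) c
        (⟦⟧⁺ _ ∘ inj₁))

      reached : ∀ {i} → y ≈ ρ → Reliable E i → side S i ≡ b → Announces E i (arrival S y)
      reached {i} y≈ρ reliable σ≡b = arrives reliable 0≤arrival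
        (trans (straight reliable (+-mono-≤ s≤y ≤-refl) ≤-refl)
          (trans (line-at (side S i) y (delay S)) (signed-cong σ≡b y≈ρ)))
        λ t 0≤t t<y → unseen-straight reliable 0≤t (<⇒≤ t<y) (inj₁ (<-≤-trans (minus-< t<y) y≤ρ))

    -- Side b exceeds the remaining faults by w, so at least w reliable robots announce on reaching
    -- the target; `profit` makes these enough.
    final : ∀ {w S} → InRound E b ρ zero w S → f ℕ.< # heard E (arrival S ρ) ℕ.+ # suspects S
    final {w} {S} round = ℕ.≤-trans profit (ℕ.+-monoˡ-≤ _ w≤)
      where
      open InRound round
      open Straight round (<⇒≤ ahead) ≤-refl (λ reliable s≤t _ → follows reliable s≤t)
      w≤ : w ℕ.≤ # heard E (arrival S ρ)
      w≤ = ℕ.+-cancelˡ-≤ f _ _ (ℕ.≤-trans (sides b) (ℕ.≤-trans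
        (count-reliable sound (λ i∈ → proj₂ (⟦⟧⁻ _ i∈))
          (λ i∈ reliable → ⟦⟧⁺ _ (reliable , _ , ≤-refl , reached refl reliable
            (proj₁ (⟦⟧⁻ _ i∈)))))
        (ℕ.≤-reflexive (ℕ.+-comm _ f))))

    -- Whoever takes part in a conflict is accused at any later one, so there is no
    -- infinite descent.

    minimal-conflict : ∀ k S e {x} → 1 ℕ.≤ e → # accused S H x ℕ.≤ k → Conflict S H e x →
                       ∃[ y ] (FirstConflict S H e y × y ≤ x)
    minimal-conflict k S e {x} 1≤e ≤k conflict with em {∃[ y ] (y < x × Conflict S H e y)}
    ... | no none = x , (conflict , λ y y<x c → none (y , y<x , c)) , ≤-refl
    ... | yes (y , y<x , c@(_ , s<y , e≤)) = descend k ≤k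
      where
      speakers⊆ : ∀ {i} → i ∈ accused S H y ⊎ i ∈ claimants S H y → i ∈ accused S H x
      speakers⊆ (inj₁ i∈) = ⟦⟧⁺ _ (Sum.map₂ (λ (t , s<t , t<y , speaks) → t , s<t , <-trans t<y
        (+-mono-<-≤ y<x ≤-refl) , speaks) (⟦⟧⁻ _ i∈))
      speakers⊆ (inj₂ i∈) = ⟦⟧⁺ _ (inj₂ (arrival S y , +-mono-<-≤ s<y ≤-refl , +-mono-<-≤ y<x
        ≤-refl , proj₂ (⟦⟧⁻ _ i∈)))
      fewer : suc (# accused S H y) ℕ.≤ # accused S H x
      fewer = ℕ.≤-trans (ℕ.+-monoˡ-≤ _ (ℕ.≤-trans 1≤e e≤))
        (ℕ.≤-trans (ℕ.≤-reflexive (ℕ.+-comm (# claimants S H y) _))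
        (#-disjoint (accused S H y) (claimants S H y) (accused S H x) (λ i∈ i∈K → proj₁
          (⟦⟧⁻ _ i∈K) i∈) speakers⊆))
      descend : ∀ k → # accused S H x ℕ.≤ k → ∃[ y ] (FirstConflict S H e y × y ≤ x)
      descend zero    ≤k = contradiction (ℕ.≤-trans fewer ≤k) λ ()
      descend (suc k) ≤k with minimal-conflict k S e 1≤e (ℕ.≤-pred (ℕ.≤-trans fewer ≤k)) c
      ... | z , first , z≤y = z , first , ≤-trans z≤y (<⇒≤ y<x)

    module _ {r w S} (round : InRound E b ρ (suc r) w S) where

      open InRound round

      private
        e h : ℕ
        e = level (suc r) w
        h = level r w

        1≤h : 1 ℕ.≤ h
        1≤h = level-positive r 1≤w

        straight-until : ∀ {y} → (∀ x → FirstConflict S H e x → y ≤ x) → ∀ {i t} → Reliable E i →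
          arrival S (reach S) ≤ t → t ≤ arrival S y → at (motion E i) t ≈ signed (side S i)
            (t - delay S)
        straight-until early reliable s≤t t≤y = trans (follows reliable s≤t)
          (resume-before r w S H em _ λ x first → ≤-trans t≤y (+-mono-≤ (early x first) ≤-refl))

      -- The target cannot be passed without a conflict: if none comes before it, the reliable
      -- robots of side b all announce there, and by the margin they are at least e.
      conflict-exists : ∃[ x ] (FirstConflict S H e x × x ≤ ρ)
      conflict-exists with em {∃[ x ] (FirstConflict S H e x × x < ρ)}
      ... | yes (x , first , x<ρ) = x , first , <⇒≤ x<ρ
      ... | no none = minimal-conflict _ S e (level-positive (suc r) 1≤w) ℕ.≤-refl
        (0≤y , ahead , ℕ.+-cancelˡ-≤ f _ _ (ℕ.≤-trans (sides-now b) (ℕ.≤-trans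
          (count-reliable accused-sound (λ i∈ → proj₂ (⟦⟧⁻ _ i∈))
            (λ i∈ reliable → ⟦⟧⁺ _ (proj₂ (⟦⟧⁻ _ i∈) , _ , reached refl reliable
              (proj₁ (⟦⟧⁻ _ i∈)) , refl)))
          (ℕ.≤-reflexive (ℕ.+-comm _ f)))))
        where
        early : ∀ x → FirstConflict S H e x → ρ ≤ x
        early x first with em {ρ ≤ x}
        ... | yes ρ≤x = ρ≤x
        ... | no  ρ≰x = contradiction (x , first , ≰⇒> ρ≰x) none
        open Straight round (<⇒≤ ahead) ≤-refl (straight-until early)

      module _ {x} (first : FirstConflict S H e x) where

        conflict-≤ : x ≤ ρ
        conflict-≤ with conflict-exists
        ... | y , first′ , y≤ρ = ≤-trans (≤-reflexive (first-unique S H first first′)) y≤ρ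

        private
          N : State
          N = next S H h x

          s<x : reach S < x
          s<x = proj₁ (proj₂ (proj₁ first))

          module Line = Straight round (<⇒≤ s<x) conflict-≤
            (straight-until λ y first′ → ≤-reflexive (first-unique S H first first′))

        open Line public using (accused-sound)

        private
          open Line hiding (accused-sound) renaming (0≤y to 0≤x)

          module Cross = Crossing f h (right S) (accused S H x) (claimants S H x)

          claimant∉accused : ∀ {i} → i ∈ claimants S H x → i ∉ accused S H x
          claimant∉accused i∈ = proj₁ (⟦⟧⁻ _ i∈)

          enough : h ℕ.+ h ℕ.≤ # claimants S H x
          enough = proj₂ (proj₂ (proj₁ first))

          on-leg : ∀ {i t} → Reliable E i → arrival S x ≤ t → t ≤ arrival N x →
                   at (motion E i) t ≈ leg (side S i) (side N i) x (delay N) t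
          on-leg {i} reliable x≤t t≤ = trans (follows reliable
            (≤-trans (+-mono-≤ (<⇒≤ s<x) ≤-refl) x≤t))
            (trans (resume-after r w S H em i first x≤t) (after-≤ r w S H x i t≤))

          next≥ : arrival S x ≤ arrival N x
          next≥ = +-monoʳ-≤ x (≤-add-double 0≤x)

          0≤next : 0# ≤ arrival N x
          0≤next = ≤-trans 0≤arrival next≥

          ≥-x : ∀ {t} → arrival S x ≤ t → - x ≤ t - delay N
          ≥-x {t} x≤t = ≤-shift x≤t (solve 3 (λ x t δ → (t :- (δ :+ (x :+ x))) :- (:- x) := t
            :- (x :+ δ)) refl x t (delay S))

          >-x : ∀ {t} → arrival S x < t → - x < t - delay N
          >-x {t} x<t = <-shift x<t (solve 3 (λ x t δ → (t :- (δ :+ (x :+ x))) :- (:- x) := t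
            :- (x :+ δ)) refl x t (delay S))

          negate-< : ∀ {y z} → y < z → - z < - y
          negate-< {y} {z} y<z = <-shift y<z (solve 2 (λ y z → (:- y) :- (:- z) := z :- y) refl y
            z)

        -- With d accused robots, at most f - d of the more than 2 (f - d) visitors are faulty, and
        -- the reliable ones have all announced by the end of the detour.
        hit : x ≈ ρ → f ℕ.< # heard E (arrival N x) ℕ.+ # accused S H x
        hit x≈ρ = ℕ.+-cancelʳ-≤ f _ _ (ℕ.≤-trans (Cross.visited #accused≤f claimant∉accused 1≤h
          enough sides-now b) (begin
          # Cross.visitors b ℕ.+ (d ℕ.+ d)  ≡⟨ ℕ.+-assoc (# Cross.visitors b) d d ⟨
          # Cross.visitors b ℕ.+ d ℕ.+ d    ≤⟨ ℕ.+-monoˡ-≤ d (count-reliable accused-sound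
            (λ i∈ → proj₂ (⟦⟧⁻ _ i∈)) visitor-heard) ⟩
          v ℕ.+ f ℕ.+ d                     ≡⟨ ℕ.+-assoc v f d ⟩
          v ℕ.+ (f ℕ.+ d)                   ≡⟨ ≡.cong (v ℕ.+_) (ℕ.+-comm f d) ⟩
          v ℕ.+ (d ℕ.+ f)                   ≡⟨ ℕ.+-assoc v d f ⟨
          v ℕ.+ d ℕ.+ f                     ∎))
          where
          open ℕ.≤-Reasoning
          d v : ℕ
          d = # accused S H x
          v = # heard E (arrival N x)

          crosser : ∀ {i} → Reliable E i → side S i ≢ b → side N i ≡ b → Announces E i
            (arrival N x)
          crosser {i} reliable σ≢b σ′≡b = arrives reliable 0≤next
            (trans (on-leg reliable next≥ ≤-refl) (trans (leg-end (side S i) (side N i) x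
              (delay N)) (signed-cong σ′≡b x≈ρ)))
            before
            where
            before : ∀ t → 0# ≤ t → t < arrival N x → ¬ at (motion E i) t ≈ signed b ρ
            before t 0≤t t<T eq with em {t ≤ arrival S x}
            ... | yes t≤ = unseen-straight reliable 0≤t t≤ (inj₂ σ≢b) eq
            ... | no  t≰ = inside (side N i) b (≤-<-trans (≤-reflexive (-‿cong (sym x≈ρ)))
                  (>-x (≰⇒> t≰)))
                (<-≤-trans (minus-< t<T) (≤-reflexive x≈ρ))
                (trans (sym (trans (on-leg reliable (<⇒≤ (≰⇒> t≰)) (<⇒≤ t<T))
                  (leg-turned x (delay N) t (λ σ≡σ′ → σ≢b (≡.trans σ≡σ′ σ′≡b))))) eq)

          visitor-heard : ∀ {i} → i ∈ Cross.visitors b → Reliable E i → i ∈ heard E (arrival N x)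
          visitor-heard {i} i∈ reliable with ⟦⟧⁻ _ i∈
          ... | visits , _ with side S i ≟ b
          ...   | yes σ≡b = ⟦⟧⁺ _ (reliable , _ , next≥ , reached x≈ρ reliable σ≡b)
          ...   | no  σ≢b = ⟦⟧⁺ _ (reliable , _ , ≤-refl , crosser reliable σ≢b
                ([ (λ σ≡b → contradiction σ≡b σ≢b) , id ]′ visits))

        advance : x < ρ → InRound E b ρ r (w ℕ.+ w ℕ.+ w) N
        advance x<ρ = record
          { 0≤reach = 0≤x
          ; 0≤delay = ≤-trans 0≤delay (≤-add-double 0≤x)
          ; ahead   = x<ρ
          ; follows = λ {i} reliable ≤t → let x≤t = ≤-trans next≥ ≤t in
              trans (follows reliable (≤-trans (+-mono-≤ (<⇒≤ s<x) ≤-refl) x≤t))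
                    (trans (resume-after r w S H em i first x≤t) (after-≥ r w S H x i ≤t))
          ; unseen  = unseen′
          ; sound   = λ i∈ → [ accused-sound , claimant-sound ]′ (x∈p∪q⁻ (accused S H x)
                (claimants S H x) i∈)
          ; sides   = λ c → ≡.subst (λ z → f ℕ.+ z ℕ.≤ # free (right N) (suspects N) c
                ℕ.+ # suspects N) (≡.sym (level-triple r w))
              (Cross.balanced #accused≤f claimant∉accused 1≤h enough sides-now c)
          ; profit  = ℕ.≤-trans profit profit′
          ; 1≤w     = ℕ.≤-trans 1≤w (ℕ.≤-trans (ℕ.m≤m+n w w) (ℕ.m≤m+n (w ℕ.+ w) w))
          }
          where
          unseen′ : ∀ {i t} → Reliable E i → 0# ≤ t → t ≤ arrival N x → ¬ at (motion E i) t
            ≈ signed b ρ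
          unseen′ {i} {t} reliable 0≤t t≤ eq with total t (arrival S x)
          ... | inj₁ t≤x = unseen-straight reliable 0≤t t≤x (inj₁ (≤-<-trans (minus-≤ t≤x) x<ρ))
                eq
          ... | inj₂ x≤t with leg-cases (side S i) (side N i) x (delay N) t
          ...   | inj₁ waits = inside (side S i) b (-ρ< 0≤x) x<ρ
                    (trans (sym (trans (on-leg reliable x≤t t≤) waits)) eq)
          ...   | inj₂ turns = inside (side N i) b (<-≤-trans (negate-< x<ρ) (≥-x x≤t))
                (≤-<-trans (minus-≤ t≤) x<ρ)
                    (trans (sym (trans (on-leg reliable x≤t t≤) turns)) eq)

          claimant-sound : ∀ {i} → i ∈ claimants S H x → i ∈ faulty E
          claimant-sound i∈ with ⟦⟧⁻ _ i∈
          ... | _ , z , announces , _ = unreliable λ reliable →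
            unseen-straight reliable (announce-time E announces) ≤-refl
              (inj₁ (≤-<-trans (minus-≤ ≤-refl) x<ρ)) (announces-at reliable announces)

          profit′ : e ℕ.+ gain r (w ℕ.+ w ℕ.+ w) ℕ.+ # suspects S ℕ.≤ gain r (w ℕ.+ w ℕ.+ w)
            ℕ.+ # suspects N
          profit′ = begin
            e ℕ.+ g ℕ.+ # suspects S                      ≡⟨ ≡.cong (ℕ._+ # suspects S)
              (ℕ.+-comm e g) ⟩
            g ℕ.+ e ℕ.+ # suspects S                      ≡⟨ ℕ.+-assoc g e _ ⟩
            g ℕ.+ (e ℕ.+ # suspects S)                    ≡⟨ ≡.cong (g ℕ.+_) (ℕ.+-comm e _) ⟩
            g ℕ.+ (# suspects S ℕ.+ e)                    ≤⟨ ℕ.+-monoʳ-≤ g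
              (ℕ.+-mono-≤ (p⊆q⇒∣p∣≤∣q∣ {p = suspects S} {accused S H x} (⟦⟧⁺ _ ∘ inj₁)) enough) ⟩
            g ℕ.+ (# accused S H x ℕ.+ # claimants S H x) ≤⟨ ℕ.+-monoʳ-≤ g
              (Cross.#D+#K≤ #accused≤f claimant∉accused 1≤h enough sides-now) ⟩
            g ℕ.+ # suspects N                            ∎
            where
            open ℕ.≤-Reasoning
            g = gain r (w ℕ.+ w ℕ.+ w)

ratio : ℕ → ℕ
ratio zero    = 1
ratio (suc r) = suc (suc (ratio r))

module Search (em : ExcludedMiddle 0ℓ) (R : CompleteOrderedField) (n f : ℕ) where

  open CompleteOrderedField R hiding (zero)
  open OrderedField R
  open LineSearch R
  open Motion em R
  open Classical em
  open Strategy em R n f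
  open Analysis em R n f

  bound : ℕ → ℝ → ℝ
  bound zero    ρ = ρ
  bound (suc r) ρ = bound r ρ + (ρ + ρ)

  ρ≤bound : ∀ r {ρ} → 0# < ρ → ρ ≤ bound r ρ
  ρ≤bound zero    0<ρ = ≤-refl
  ρ≤bound (suc r) 0<ρ = ≤-trans (ρ≤bound r 0<ρ) (≤-add-double (<⇒≤ 0<ρ))

  next-≡ : ∀ S H H′ h x → Agree (arrival S x) H H′ → next S H h x ≡ next S H′ h x
  next-≡ S H H′ h x agree = ≡.cong₂ (after-conflict S h x)
    (accused-resp {H = H} {H′} (≋-refl {S}) refl agree) (claimants-resp {H = H} {H′} (≋-refl {S})
      refl agree)

  module _ {A : Algorithm n} where

    resolve : ∀ r w S {E : Scenario A f} {b ρ} → 0# < ρ → target E ≈ signed b ρ →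
      InRound E b ρ r w S →
      ∃[ T ] (arrival S (reach S) ≤ T × T ≤ bound r ρ + delay S ×
              (∃[ D ] ((∀ {i} → i ∈ D → i ∈ faulty E) × f ℕ.< # heard E T ℕ.+ # D)) ×
              (∀ {E′ : Scenario A f} {b′ ρ′} → 0# < ρ′ → target E′ ≈ signed b′ ρ′ →
               InRound E′ b′ ρ′ r w S →
               Agree T (history E) (history E′) → target E′ ≈ target E))
    resolve zero w S {E} {b} {ρ} 0<ρ target≈ round =
      arrival S ρ , +-mono-≤ (<⇒≤ (InRound.ahead round)) ≤-refl , ≤-refl ,
      (suspects S , InRound.sound round , votes) ,
      λ {E′} _ _ round′ agree →
        sym (same-target E E′ _ (InRound.sound round) (InRound.sound round′) votes agree)
      where
      votes : f ℕ.< # heard E (arrival S ρ) ℕ.+ # suspects S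
      votes = InScenario.final E b ρ 0<ρ target≈ round
    resolve (suc r) w S {E} {b} {ρ} 0<ρ target≈ round
      with InScenario.conflict-exists E b ρ 0<ρ target≈ round
    ... | x , first , x≤ρ with em {x ≈ ρ}
    ... | yes x≈ρ =
      arrival N x , ≤-trans (+-mono-≤ (<⇒≤ s<x) ≤-refl) next≥ , T≤ ,
        (accused S H x , Actual.accused-sound round first , votes) ,
      λ {E′} {b′} {ρ′} 0<ρ′ target′≈ round′ agree →
        let module Rival = InScenario E′ b′ ρ′ 0<ρ′ target′≈
            H′ = history E′
            agree-x = agree-mono {H = H} {H′} next≥ agree
            first′ = first-resp {H = H} {H′} (≋-refl {S}) refl agree-x first
        in sym (same-target E E′ _ (Actual.accused-sound round first)
             (Rival.accused-sound round′ first′ ∘ ≡.subst (_ ∈_) (accused-resp {H = H} {H′}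
               (≋-refl {S}) refl agree-x)) votes agree)
      where
      module Actual = InScenario E b ρ 0<ρ target≈
      H = history E
      N = next S H (level r w) x
      s<x : reach S < x
      s<x = proj₁ (proj₂ (proj₁ first))
      next≥ : arrival S x ≤ arrival N x
      next≥ = +-monoʳ-≤ x (≤-add-double (proj₁ (proj₁ first)))
      votes : f ℕ.< # heard E (arrival N x) ℕ.+ # accused S H x
      votes = Actual.hit round first x≈ρ
      T≤ : arrival N x ≤ bound r ρ + (ρ + ρ) + delay S
      T≤ = ≤-shift (+-mono-≤ (≤-trans x≤ρ (ρ≤bound r 0<ρ)) (+-mono-≤ x≤ρ x≤ρ))
        (solve 4 (λ x ρ β δ → (β :+ (ρ :+ ρ) :+ δ) :- (x :+ (δ :+ (x :+ x))) := (β :+ (ρ :+ ρ))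
          :- (x :+ (x :+ x))) refl x ρ (bound r ρ) (delay S))
    ... | no x≉ρ with resolve r (w ℕ.+ w ℕ.+ w) (next S (history E) (level r w) x) 0<ρ target≈
                        (InScenario.advance E b ρ 0<ρ target≈ round first (x≤ρ , x≉ρ))
    ...   | T , ≤T , T≤ , votes , unique =
      T , ≤-trans (+-mono-≤ (<⇒≤ s<x) ≤-refl) (≤-trans next≥ ≤T) , T≤′ , votes ,
      λ {E′} 0<ρ′ target′≈ round′ agree → certain E′ 0<ρ′ target′≈ round′ agree
      where
      module Actual = InScenario E b ρ 0<ρ target≈
      H = history E
      N = next S H (level r w) x
      s<x : reach S < x
      s<x = proj₁ (proj₂ (proj₁ first))
      next≥ : arrival S x ≤ arrival N x
      next≥ = +-monoʳ-≤ x (≤-add-double (proj₁ (proj₁ first)))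
      T≤′ : T ≤ bound r ρ + (ρ + ρ) + delay S
      T≤′ = ≤-trans T≤ (≤-shift (+-mono-≤ x≤ρ x≤ρ)
        (solve 4 (λ x ρ β δ → (β :+ (ρ :+ ρ) :+ δ) :- (β :+ (δ :+ (x :+ x))) := (ρ :+ ρ)
          :- (x :+ x)) refl x ρ (bound r ρ) (delay S)))
      certain : ∀ (E′ : Scenario A f) {b′ ρ′} → 0# < ρ′ → target E′ ≈ signed b′ ρ′ →
                InRound E′ b′ ρ′ (suc r) w S → Agree T H (history E′) → target E′ ≈ target E
      certain E′ {b′} {ρ′} 0<ρ′ target′≈ round′ agree with em {x ≈ ρ′}
      ... | yes x≈ρ′ = same-target E′ E _ (Rival.accused-sound round′ first′)
              (Actual.accused-sound round first ∘ ≡.subst (_ ∈_)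
                (≡.sym (accused-resp {H = H} {history E′} (≋-refl {S}) refl agree-x)))
              (Rival.hit round′ first′ x≈ρ′)
              (agree-mono {H = history E′} {H} ≤T (agree-sym {H = H} {history E′} agree))
        where
        module Rival = InScenario E′ b′ ρ′ 0<ρ′ target′≈
        agree-x : Agree (arrival S x) H (history E′)
        agree-x = agree-mono {H = H} {history E′} (≤-trans next≥ ≤T) agree
        first′ : FirstConflict S (history E′) (level (suc r) w) x
        first′ = first-resp {H = H} {history E′} (≋-refl {S}) refl agree-x first
      ... | no x≉ρ′ = unique 0<ρ′ target′≈
              (≡.subst (InRound E′ b′ ρ′ r (w ℕ.+ w ℕ.+ w))
                (≡.sym (next-≡ S H (history E′) (level r w) x agree-x))
                (Rival.advance round′ first′ (Rival.conflict-≤ round′ first′ , x≉ρ′)))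
              agree
        where
        module Rival = InScenario E′ b′ ρ′ 0<ρ′ target′≈
        agree-x : Agree (arrival S x) H (history E′)
        agree-x = agree-mono {H = H} {history E′} (≤-trans next≥ ≤T) agree
        first′ : FirstConflict S (history E′) (level (suc r) w) x
        first′ = first-resp {H = H} {history E′} (≋-refl {S}) refl agree-x first

  oriented : ∀ {x} → ¬ x ≈ 0# → ∃[ b ] ∃[ ρ ] (0# < ρ × x ≈ signed b ρ)
  oriented {x} x≉0 with total 0# x
  ... | inj₁ 0≤x = true , x , (0≤x , λ 0≈x → x≉0 (sym 0≈x)) , refl
  ... | inj₂ x≤0 = false , - x , positive (x≤0 , x≉0) , solve 1 (λ x → x := :- (:- x)) refl x

  bound≈ : ∀ r ρ → bound r ρ ≈ fromℕ (ratio r) * ρ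
  bound≈ zero    ρ = sym (trans (*-congʳ (+-identityʳ 1#)) (*-identityˡ ρ))
  bound≈ (suc r) ρ = begin
    bound r ρ + (ρ + ρ)                ≈⟨ +-cong (bound≈ r ρ)
      (sym (+-cong (*-identityˡ ρ) (*-identityˡ ρ))) ⟩
    fromℕ k * ρ + (1# * ρ + 1# * ρ)    ≈⟨ solve 3 (λ k o ρ → k :* ρ :+ (o :* ρ :+ o :* ρ) :=
      (o :+ (o :+ k)) :* ρ) refl (fromℕ k) 1# ρ ⟩
    (1# + (1# + fromℕ k)) * ρ          ∎
    where
    open SetoidReasoning setoid
    k = ratio r

  module Execution (J m : ℕ) where

    half : ℕ
    half = f ℕ.+ level J m

    initial : State
    initial = record { right = take ⊤ half ; suspects = ⊥ ; reach = 0# ; delay = 0# }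

    origin : arrival initial 0# ≈ 0#
    origin = +-identityʳ 0#

    algorithm : Algorithm n
    algorithm = record
      { plan   = λ H i → trajectory (path-feasible J m initial H i) (trans
          (Feasible.congruent (path-feasible J m initial H i) (sym origin))
          (trans (path-start J m initial H i) (signed-0 (side initial i))))
      ; causal = λ _ agree i → path-resp J m i ≋-refl agree
      }
      where
      signed-0 : ∀ b → signed b 0# ≈ 0#
      signed-0 true  = refl
      signed-0 false = trans (sym (+-identityˡ (- 0#))) (-‿inverseʳ 0#)

    module _ (1≤m : 1 ℕ.≤ m) (large : half ℕ.+ half ℕ.≤ n) (f<gain : f ℕ.< gain J m) where

      begins : ∀ (E : Scenario algorithm f) {b ρ} → 0# < ρ → InRound E b ρ J m initial
      begins E {b} {ρ} 0<ρ = record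
        { 0≤reach = ≤-refl
        ; 0≤delay = ≤-refl
        ; ahead   = 0<ρ
        ; follows = λ reliable ≤t → reliable-motion E reliable _ (≤-respˡ-≈ origin ≤t)
        ; unseen  = λ {i} reliable 0≤t t≤ eq → inside true b (negative 0<ρ) 0<ρ (trans
            (sym (trans (at-cong (motion E i) (antisym (≤-respʳ-≈ origin t≤) 0≤t))
              (start (motion E i)))) eq)
        ; sound   = λ i∈ → contradiction i∈ ∉⊥
        ; sides   = λ c → ℕ.≤-trans (half≤ c) (ℕ.m≤m+n (# free (take {n} ⊤ half) ⊥ c) (# ⊥ {n}))
        ; profit  = ℕ.≤-trans f<gain (ℕ.m≤m+n (gain J m) (# ⊥ {n}))
        ; 1≤w     = 1≤m
        }
        where
        right₀ : Subset n
        right₀ = take ⊤ half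
        #right₀ : # right₀ ≡ half
        #right₀ = #-take (⊤ {n}) (≡.subst (half ℕ.≤_) (≡.sym (∣⊤∣≡n n))
          (ℕ.≤-trans (ℕ.m≤m+n half half) large))
        #left₀ : # ∁ right₀ ≡ n ℕ.∸ half
        #left₀ = ≡.trans (∣∁p∣≡n∸∣p∣ right₀) (≡.cong (n ℕ.∸_) #right₀)
        right₀⊆ : ∀ {i} → i ∈ right₀ → i ∈ free right₀ ⊥ true
        right₀⊆ i∈ = ⟦⟧⁺ _ ([]=⇒lookup i∈ , ∉⊥)
        left₀⊆ : ∀ {i} → i ∈ ∁ right₀ → i ∈ free right₀ ⊥ false
        left₀⊆ {i} i∈ = ⟦⟧⁺ _ (¬-not (x∈∁p⇒x∉p {p = right₀} i∈ ∘ lookup⇒[]= i right₀) , ∉⊥)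
        half≤ : ∀ c → half ℕ.≤ # free right₀ ⊥ c
        half≤ true  = ≡.subst (ℕ._≤ # free right₀ ⊥ true) #right₀ (p⊆q⇒∣p∣≤∣q∣ {p = right₀}
          {free right₀ ⊥ true} right₀⊆)
        half≤ false = ℕ.≤-trans (ℕ.m+n≤o⇒m≤o∸n half large)
          (≡.subst (ℕ._≤ # free right₀ ⊥ false) #left₀ (p⊆q⇒∣p∣≤∣q∣ {p = ∁ right₀}
            {free right₀ ⊥ false} left₀⊆))

      search : SearchTime≤ n f (fromℕ (ratio J))
      search = algorithm , solved
        where
        solved : ∀ d → 0# < d → ∀ (E : Scenario algorithm f) → target E ≈ d ⊎ target E ≈ - d →
                 ∃[ T ] (T ≤ fromℕ (ratio J) * d × Completed E T)
        solved d 0<d E at-±d with oriented-at at-±d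
          where
          oriented-at : target E ≈ d ⊎ target E ≈ - d → ∃[ b ] target E ≈ signed b d
          oriented-at (inj₁ at-d)  = true , at-d
          oriented-at (inj₂ at--d) = false , at--d
        ... | b , target≈ with resolve J m initial {b = b} 0<d target≈ (begins E 0<d)
        ...   | T , _ , T≤ , (D , sound , votes) , unique with common-witness E E T sound sound
              votes
        ...     | i , reliable , _ , t , t≤T , announces =
          T , ≤-respʳ-≈ (trans (+-identityʳ _) (bound≈ J d)) T≤ ,
          (i , t , reliable , t≤T , at-target E reliable announces , announces) ,
          λ E′ agree → let b′ , ρ′ , 0<ρ′ , target′≈ = oriented (target≉0 E′) in
            unique {b′ = b′} 0<ρ′ target′≈ (begins E′ 0<ρ′) agree

level-* : ∀ r w m → level r (w ℕ.* m) ≡ level r w ℕ.* m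
level-* zero    w m = ≡.refl
level-* (suc r) w m = ≡.trans (≡.cong₂ ℕ._+_ (level-* r w m) (level-* r w m))
  (≡.sym (ℕ.*-distribʳ-+ m (level r w) (level r w)))

gain-* : ∀ r w m → gain r (w ℕ.* m) ≡ gain r w ℕ.* m
gain-* zero    w m = ≡.refl
gain-* (suc r) w m = ≡.trans
  (≡.cong₂ ℕ._+_ (level-* (suc r) w m) (≡.trans (≡.cong (gain r) triple) (gain-* r (w ℕ.+ w ℕ.+ w)
    m)))
  (≡.sym (ℕ.*-distribʳ-+ m (level (suc r) w) _))
  where
  triple : w ℕ.* m ℕ.+ w ℕ.* m ℕ.+ w ℕ.* m ≡ (w ℕ.+ w ℕ.+ w) ℕ.* m
  triple = solve′ 2 (λ w m → w ⊛ m ⊕ w ⊛ m ⊕ w ⊛ m ⊜ (w ⊕ w ⊕ w) ⊛ m) ≡.refl w m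
    where open +-*-Solver renaming (solve to solve′; _:+_ to _⊕_; _:*_ to _⊛_; _:=_ to _⊜_)

module Archimedean (em : ExcludedMiddle 0ℓ) (R : CompleteOrderedField) where

  open CompleteOrderedField R hiding (zero)
  open OrderedField R
  open RingProperties ring using (-0#≈0#)

  private
    x-0≈x : ∀ x → x - 0# ≈ x
    x-0≈x x = trans (+-congˡ -0#≈0#) (+-identityʳ x)

  *-monoʳ-≤ : ∀ {x y z} → 0# ≤ z → x ≤ y → x * z ≤ y * z
  *-monoʳ-≤ {x} {y} {z} 0≤z x≤y = ≤-shift (*-nonNeg 0≤y-x 0≤z)
    (trans (solve 3 (λ x y z → y :* z :- x :* z := (y :- x) :* z) refl x y z) (sym (x-0≈x _)))
    where
    0≤y-x : 0# ≤ y - x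
    0≤y-x = ≤-shift x≤y (x-0≈x (y - x))

  0≤-x : ∀ {x} → x ≤ 0# → 0# ≤ - x
  0≤-x {x} x≤0 = ≤-shift x≤0 (trans (x-0≈x (- x)) (sym (+-identityˡ (- x))))

  0<1 : 0# < 1#
  0<1 with total 0# 1#
  ... | inj₁ 0≤1 = 0≤1 , 0≉1
  ... | inj₂ 1≤0 = ≤-respʳ-≈ (trans (solve 1 (λ o → (:- o) :* (:- o) := o :* o) refl 1#)
        (*-identityˡ 1#)) (*-nonNeg (0≤-x 1≤0) (0≤-x 1≤0)) , 0≉1

  ⁻¹-nonNeg : ∀ {x} → 0# < x → 0# ≤ x ⁻¹
  ⁻¹-nonNeg {x} (0≤x , 0≉x) with total 0# (x ⁻¹)
  ... | inj₁ 0≤x⁻¹ = 0≤x⁻¹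
  ... | inj₂ x⁻¹≤0 = contradiction (≤-shift (*-nonNeg 0≤x (0≤-x x⁻¹≤0)) (begin
      0# - 1#            ≈⟨ +-identityˡ (- 1#) ⟩
      - 1#               ≈⟨ -‿cong (*-inverseʳ (0≉x ∘ sym)) ⟨
      - (x * x ⁻¹)       ≈⟨ solve 2 (λ x y → :- (x :* y) := x :* (:- y)) refl x (x ⁻¹) ⟩
      x * - (x ⁻¹)       ≈⟨ x-0≈x _ ⟨
      x * - (x ⁻¹) - 0#  ∎)) (<⇒≱ 0<1)
    where open SetoidReasoning setoid

  fromℕ-< : ∀ n → fromℕ n < fromℕ (suc n)
  fromℕ-< n = <-shift 0<1 (trans (solve 2 (λ o x → (o :+ x) :- x := o) refl 1# (fromℕ n))
    (sym (x-0≈x 1#)))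

  fromℕ-mono-≤ : ∀ {m n} → m ℕ.≤ n → fromℕ m ≤ fromℕ n
  fromℕ-mono-≤ = go ∘ ℕ.≤⇒≤′
    where
    go : ∀ {m n} → m ℕ.≤′ n → fromℕ m ≤ fromℕ n
    go ℕ.≤′-refl       = ≤-refl
    go (ℕ.≤′-step {n} m≤n) = ≤-trans (go m≤n) (<⇒≤ (fromℕ-< n))

  fromℕ-cancel-≤ : ∀ {m n} → fromℕ m ≤ fromℕ n → m ℕ.≤ n
  fromℕ-cancel-≤ {m} {n} le with m ℕ.≤? n
  ... | yes m≤n = m≤n
  ... | no  m≰n = contradiction (≤-trans (fromℕ-mono-≤ (ℕ.≰⇒> m≰n)) le) (<⇒≱ (fromℕ-< n))

  archimedean : ∀ x → ∃[ n ] x ≤ fromℕ n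
  archimedean x with em {∃[ n ] x ≤ fromℕ n}
  ... | yes found = found
  ... | no  none with supremum (λ y → ∃[ n ] y ≈ fromℕ n) (_ , 0 , refl)
                    (x , λ { y (n , y≈n) → ≤-respˡ-≈ (sym y≈n) (<⇒≤ (≰⇒> λ x≤n → none (n , x≤n)))
                      })
  ...   | s , upper , least = contradiction
    (≤-shift (least (s - 1#) below) (trans (+-identityˡ (- 1#))
      (solve 2 (λ s o → :- o := (s :- o) :- s) refl s 1#)))
    (<⇒≱ 0<1)
    where
    below : UpperBound (λ y → ∃[ n ] y ≈ fromℕ n) (s - 1#)
    below y (n , y≈n) = ≤-respˡ-≈ (sym y≈n) (≤-shift (upper (fromℕ (suc n)) (suc n , refl))
      (solve 3 (λ s o x → (s :- o) :- x := s :- (o :+ x)) refl s 1# (fromℕ n)))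

  ceiling : ∀ {x} → 0# ≤ x → ∃[ n ] ⌈ x ⌉≈ n
  ceiling {x} 0≤x = descend (proj₁ (archimedean x)) (proj₂ (archimedean x))
    where
    descend : ∀ n → x ≤ fromℕ n → ∃[ n ] ⌈ x ⌉≈ n
    descend zero    x≤0 = 0 , x≤0 , <-respˡ-≈ (+-identityʳ 0#) (<-respʳ-≈ (+-comm 1# x)
      (+-mono-<-≤ 0<1 0≤x))
    descend (suc n) x≤ with em {x ≤ fromℕ n}
    ... | yes x≤n = descend n x≤n
    ... | no  x≰n = suc n , x≤ , <-shift (≰⇒> x≰n)
      (solve 3 (λ x o y → (x :+ o) :- (o :+ y) := x :- y) refl x 1# (fromℕ n))

module Upper (em : ExcludedMiddle 0ℓ) (R : CompleteOrderedField) where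

  open CompleteOrderedField R hiding (zero)
  open OrderedField R
  open LineSearch R
  open Archimedean em R

  enough-robots : ∀ a l f n .{{_ : ℕ.NonZero a}} →
    ((a ℕ.+ l) ℕ.+ (a ℕ.+ l)) ℕ.* f ℕ.+ a ℕ.* (l ℕ.+ l) ℕ.≤ a ℕ.* n →
    let m = suc (f ℕ./ a) in f ℕ.< a ℕ.* m × (f ℕ.+ l ℕ.* m) ℕ.+ (f ℕ.+ l ℕ.* m) ℕ.≤ n
  enough-robots a l f n enough = f<am , ℕ.*-cancelˡ-≤ a (begin
    a ℕ.* ((f ℕ.+ l ℕ.* m) ℕ.+ (f ℕ.+ l ℕ.* m))
      ≡⟨ solve′ 4 (λ a l f m → a ⊛ ((f ⊕ l ⊛ m) ⊕ (f ⊕ l ⊛ m)) ⊜ (a ⊕ a) ⊛ f ⊕ (l ⊕ l) ⊛ (a ⊛ m))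
        ≡.refl a l f m ⟩
    (a ℕ.+ a) ℕ.* f ℕ.+ (l ℕ.+ l) ℕ.* (a ℕ.* m)
      ≤⟨ ℕ.+-monoʳ-≤ ((a ℕ.+ a) ℕ.* f) (ℕ.*-monoʳ-≤ (l ℕ.+ l) am≤) ⟩
    (a ℕ.+ a) ℕ.* f ℕ.+ (l ℕ.+ l) ℕ.* (a ℕ.+ f)
      ≡⟨ solve′ 3 (λ a l f → (a ⊕ a) ⊛ f ⊕ (l ⊕ l) ⊛ (a ⊕ f) ⊜ ((a ⊕ l) ⊕ (a ⊕ l)) ⊛ f ⊕ a ⊛
        (l ⊕ l)) ≡.refl a l f ⟩
    ((a ℕ.+ l) ℕ.+ (a ℕ.+ l)) ℕ.* f ℕ.+ a ℕ.* (l ℕ.+ l)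
      ≤⟨ enough ⟩
    a ℕ.* n ∎)
    where
    open +-*-Solver renaming (solve to solve′; _:+_ to _⊕_; _:*_ to _⊛_; _:=_ to _⊜_)
    open ℕ.≤-Reasoning
    m : ℕ
    m = suc (f ℕ./ a)
    f<am : f ℕ.< a ℕ.* m
    f<am = begin-strict
      f                            ≡⟨ ℕ.m≡m%n+[m/n]*n f a ⟩
      f ℕ.% a ℕ.+ f ℕ./ a ℕ.* a    <⟨ ℕ.+-monoˡ-< _ (ℕ.m%n<n f a) ⟩
      a ℕ.+ f ℕ./ a ℕ.* a          ≡⟨ ℕ.*-comm m a ⟩
      a ℕ.* m                      ∎
    am≤ : a ℕ.* m ℕ.≤ a ℕ.+ f
    am≤ = begin
      a ℕ.* m              ≡⟨ ℕ.*-comm a m ⟩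
      a ℕ.+ f ℕ./ a ℕ.* a  ≤⟨ ℕ.+-monoʳ-≤ a (ℕ.m/n*n≤m f a) ⟩
      a ℕ.+ f              ∎

  cross-multiply : ∀ {a b} β x c n → 0# < β → 0# < b → 0# ≤ x → 0# ≤ a →
    β ≤ a / b → x / β + c ≤ n → b * x + a * c ≤ a * n
  cross-multiply {a} {b} β x c n 0<β 0<b 0≤x 0≤a β≤ ceil = begin
    b * x + a * c                    ≈⟨ +-congʳ (*-identityʳ (b * x)) ⟨
    b * x * 1# + a * c               ≈⟨ +-congʳ (*-congˡ (*-inverseʳ (proj₂ 0<β ∘ sym))) ⟨
    b * x * (β * β ⁻¹) + a * c       ≈⟨ solve 6 (λ a b β β′ x c → b :* x :* (β :* β′) :+ a :* c :=
      β :* b :* (x :* β′) :+ a :* c) refl a b β (β ⁻¹) x c ⟩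
    β * b * (x / β) + a * c          ≤⟨ +-mono-≤ (*-monoʳ-≤ 0≤x/β βb≤a) ≤-refl ⟩
    a * (x / β) + a * c              ≈⟨ solve 3 (λ a y c → a :* y :+ a :* c := (y :+ c) :* a) refl
      a (x / β) c ⟩
    (x / β + c) * a                  ≤⟨ *-monoʳ-≤ 0≤a ceil ⟩
    n * a                            ≈⟨ *-comm n a ⟩
    a * n                            ∎
    where
    open PosetReasoning poset
    0≤x/β : 0# ≤ x / β
    0≤x/β = *-nonNeg 0≤x (⁻¹-nonNeg 0<β)
    βb≤a : β * b ≤ a
    βb≤a = begin
      β * b          ≤⟨ *-monoʳ-≤ (<⇒≤ 0<b) β≤ ⟩
      a * b ⁻¹ * b   ≈⟨ solve 3 (λ a b b′ → a :* b′ :* b := a :* (b :* b′)) refl a b (b ⁻¹) ⟩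
      a * (b * b ⁻¹) ≈⟨ *-congˡ (*-inverseʳ (proj₂ 0<b ∘ sym)) ⟩
      a * 1#         ≈⟨ *-identityʳ a ⟩
      a              ∎

  upper-bound : ∀ J .{{_ : ℕ.NonZero (gain J 1)}} β → 0# < β →
    let s = gain J 1 ℕ.+ level J 1 in
    β ≤ fromℕ (gain J 1) / fromℕ (s ℕ.+ s) → Ŝ[ β ]≤ fromℕ (ratio J)
  upper-bound J β 0<β β≤ = fromℕ (ratio J) , ≤-refl , fromℕ (l ℕ.+ l) , λ f _ →
    let 0≤request = ≤-respˡ-≈ (+-identityʳ 0#) (+-mono-≤ (*-nonNeg (0≤fromℕ f) (⁻¹-nonNeg 0<β))
          (0≤fromℕ (l ℕ.+ l)))
        n , x≤n , n<x+1 = ceiling 0≤request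
        f<am , large = enough-robots a l f n (fromℕ-cancel-≤
          (≤-respˡ-≈ (sym (trans (fromℕ-+ (b ℕ.* f) (a ℕ.* (l ℕ.+ l))) (+-cong (fromℕ-* b f)
            (fromℕ-* a (l ℕ.+ l)))))
          (≤-respʳ-≈ (sym (fromℕ-* a n))
          (cross-multiply β (fromℕ f) (fromℕ (l ℕ.+ l)) (fromℕ n) 0<β 0<b (0≤fromℕ f) (0≤fromℕ a)
            β≤ x≤n))))
        m = suc (f ℕ./ a)
        level≡ = ≡.trans (≡.cong (level J) (≡.sym (ℕ.*-identityˡ m))) (level-* J 1 m)
        gain≡  = ≡.trans (≡.cong (gain J) (≡.sym (ℕ.*-identityˡ m))) (gain-* J 1 m)
    in n , (x≤n , n<x+1) , Search.Execution.search em R n f J m (ℕ.s≤s ℕ.z≤n)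
         (≡.subst (λ z → f ℕ.+ z ℕ.+ (f ℕ.+ z) ℕ.≤ n) (≡.sym level≡) large)
         (≡.subst (f ℕ.<_) (≡.sym gain≡) f<am)
    where
    a l b : ℕ
    a = gain J 1
    l = level J 1
    b = (a ℕ.+ l) ℕ.+ (a ℕ.+ l)
    0≤fromℕ : ∀ k → 0# ≤ fromℕ k
    0≤fromℕ k = fromℕ-mono-≤ (ℕ.z≤n {k})
    0<b : 0# < fromℕ b
    0<b = <-≤-trans (fromℕ-< 0) (fromℕ-mono-≤
      (ℕ.≤-trans (ℕ.>-nonZero⁻¹ a) (ℕ.≤-trans (ℕ.m≤m+n a l) (ℕ.m≤m+n (a ℕ.+ l) (a ℕ.+ l)))))

theorem4 : (∀ ℓ → ExcludedMiddle ℓ) → (R : CompleteOrderedField) →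
    let open CompleteOrderedField R
        open LineSearch R
    in ∀ (β : ℝ) → 0# < β →
       (β ≤ fromℕ 19 / fromℕ 46 → Ŝ[ β ]≤ fromℕ 5) ×
       (β ≤ fromℕ 65 / fromℕ 146 → Ŝ[ β ]≤ fromℕ 7)
theorem4 em R β 0<β = upper-bound 2 β 0<β , upper-bound 3 β 0<β
  where open Upper (em 0ℓ) R
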